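{- There is an absolute constant $C'$ such that if $G$ is a finite group of order $N$ with an abelian subgroup $H$ whose order is coprime to $6$ and satisfies $|H|>N/(\log N)^{1/1000}$, then $G$ has a Cayley graph which is $C'$-Ramsey.
   Context: For a group $G$ and $S\subseteq G\setminus\{1\}$ with $S=S^{ -1}$, the Cayley graph $G_S$ has vertex set $G$, with $x,y$ adjacent iff $xy^{ -1}\in S$. A graph on $N$ vertices is $C'$-Ramsey if both its clique number and independence number are at most $C'\log N$. -}

module Defs where

open import Data.Nat using (ℕ; _+_; _*_; _∸_; _^_; _≤_; _<_)
open import Data.Nat.Logarithm using (⌊log₂_⌋)
open import Data.Nat.Coprimality using (Coprime)
open import Data.Fin using (Fin)
open import Data.Fin.Subset using (Subset; _∈_; _∉_; ∣_∣)
open import Data.Product using (Σ; ∃; ∃-syntax; _×_)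
open import Relation.Nullary using (¬_)
open import Relation.Binary.PropositionalEquality using (_≡_; _≢_)
open import Algebra.Structures using (IsGroup)

-- A finite group of order N, presented (WLOG, up to isomorphism) on the
-- carrier Fin N with propositional equality.
record FiniteGroup (N : ℕ) : Set where
  field
    _∙_     : Fin N → Fin N → Fin N
    ε       : Fin N
    _⁻¹     : Fin N → Fin N
    isGroup : IsGroup _≡_ _∙_ ε _⁻¹

module _ {N : ℕ} (G : FiniteGroup N) where
  open FiniteGroup G

  IsSubgroup : Subset N → Set
  IsSubgroup H = (ε ∈ H)
               × (∀ x y → x ∈ H → y ∈ H → (x ∙ y) ∈ H)
               × (∀ x → x ∈ H → (x ⁻¹) ∈ H)

  IsAbelianSubgroup : Subset N → Set
  IsAbelianSubgroup H = IsSubgroup H × (∀ x y → x ∈ H → y ∈ H → (x ∙ y) ≡ (y ∙ x))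

  IsConnectionSet : Subset N → Set
  IsConnectionSet S = (ε ∉ S) × (∀ x → x ∈ S → (x ⁻¹) ∈ S)

  Adj : Subset N → Fin N → Fin N → Set
  Adj S x y = (x ∙ (y ⁻¹)) ∈ S

  IsClique : Subset N → Subset N → Set
  IsClique S K = ∀ x y → x ∈ K → y ∈ K → x ≢ y → Adj S x y

  IsIndependent : Subset N → Subset N → Set
  IsIndependent S K = ∀ x y → x ∈ K → y ∈ K → x ≢ y → ¬ Adj S x y

  IsRamsey : ℕ → Subset N → Set
  IsRamsey C S = (∀ K → IsClique S K → ∣ K ∣ ≤ C * ⌊log₂ N ⌋)
               × (∀ K → IsIndependent S K → ∣ K ∣ ≤ C * ⌊log₂ N ⌋)

-- ExpLt p q N  encodes the real inequality  e^(p/q) < N.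
-- Since (1 - t/n)^(-n) decreases to e^t for n > t, e^t < N iff for some
-- n > t we have N (1 - t/n)^n > 1; with t = p/q this is the condition below.
ExpLt : ℕ → ℕ → ℕ → Set
ExpLt p q N = ∃[ n ] (p < n * q) × ((n * q) ^ n < N * ((n * q ∸ p) ^ n))

{-# OPTIONS --safe #-}
module Submission where

-- A Cayley graph is drawn at random, one fair bit colouring each pair {z, z⁻¹}; but in H (written
-- additively) a maximal family of disjoint sets {±y, ±2y} is chosen, in each of which one bit colours
-- y and 2y oppositely.  As |H| is prime to 6, no d ≠ 0 in H has d, 2d, 4d, 8d all of one colour.
--
-- Let A be a clique or independent set of n = 256 log N vertices, with T = |A A⁻¹|.
--  * Some coset of H contains a large part D of A.  If T were small, a pigeonhole argument on
--    (x, x′, x″, a) ↦ (x − 2a, x′ − 4a, x″ − 8a) would give d, 2d, 4d, 8d ∈ D − D.  Hence T ≥ n^(1+c).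
--  * A is spelled by words of length O([G : H] log n) in O(T/n + [G : H] log n) group elements.  A
--    greedy set B with |B| = O(T/n) has a v⁻¹ ∈ A B⁻¹ for all v and most a in A.  As long as half of A
--    is not spelled, some unspelled a maps a proportion 1/(2 [G : H]) of a family V, kept distinct
--    modulo B, to new vertices a v⁻¹ b of A, so V grows exponentially; commutativity of H transfers
--    distinctness from one side to the other, coset by coset.
--  * At least T/4 − 1 independent bits are forced by A, so a union bound over all spellings is < 1.

open import Defs
open import Data.Nat hiding (_≟_)
open import Data.Nat.Properties hiding (_≟_)
open import Data.Nat.Coprimality using (Coprime)
open import Data.Nat.DivMod using (_/_; m/n*n≤m; m*n/n≡m; /-monoˡ-≤)
open import Data.Nat.Divisibility using (_∣_; divides; divides-refl)
open import Data.Nat.ListAction using (sum)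
open import Data.Nat.ListAction.Properties using (sum-++)
open import Data.Nat.Logarithm using (⌊log₂_⌋; ⌊log₂⌋-mono-≤; ⌊log₂[2^n]⌋≡n)
open import Data.Nat.Solver using (module +-*-Solver)
open import Data.Bool using (Bool; true; false; not; _xor_; if_then_else_)
import Data.Bool.Properties as Boolₚ
open import Data.Empty using (⊥; ⊥-elim)
open import Data.Fin using (Fin; zero; suc)
import Data.Fin as Fin
import Data.Fin.Properties as Finₚ
open import Data.Fin.Patterns using (0F; 1F; 2F; 3F; 4F)
open import Data.Fin.Properties using (_≟_)
open import Data.Fin.Subset as Subset using (Subset; ∣_∣; inside; outside) renaming (_∈_ to _∈ₛ_)
open import Data.Fin.Subset.Properties using (∉⊥; ∣p∣≤n) renaming (_∈?_ to _∈ₛ?_)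
open import Data.List.Base hiding (find; sum)
open import Data.List.Membership.Propositional using (_∈_; _∉_; find; lose)
open import Data.List.Membership.Propositional.Properties
import Data.List.Membership.DecPropositional as DecMembership
open import Data.List.Properties using (length-++; length-map; length-filter; length-tabulate; length-replicate; length-deduplicate; length-take; length-upTo; map-∘; map-++)
open import Data.List.Relation.Binary.Pointwise using (Pointwise-length)
open import Data.List.Relation.Binary.Pointwise.Base using (Pointwise; []; _∷_)
open import Data.List.Relation.Unary.All as All using (All; []; _∷_)
open import Data.List.Relation.Unary.AllPairs as AllPairs using (AllPairs; []; _∷_)
import Data.List.Relation.Unary.AllPairs.Properties as AllPairsₚ
open import Data.List.Relation.Unary.Any as Any using (Any; here; there; any?)
open import Data.List.Relation.Unary.Unique.Propositional using (Unique)
import Data.List.Relation.Unary.Unique.DecPropositional.Properties as UnqDec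
import Data.List.Relation.Unary.Unique.Propositional.Properties as Unq
open import Data.Product using (Σ; ∃; ∃₂; ∃-syntax; _×_; _,_; proj₁; proj₂)
open import Data.Product.Properties using (≡-dec)
open import Data.Sum using (_⊎_; inj₁; inj₂)
open import Data.Vec.Base as Vec using (Vec; []; _∷_)
open import Data.Vec.Properties using (lookup∘tabulate; lookup⇒[]=; []=⇒lookup)
open import Algebra.Bundles using (Group; AbelianGroup)
import Algebra.Properties.AbelianGroup as AbelianGroupₚ
import Algebra.Properties.Group as Groupₚ
import Algebra.Solver.CommutativeMonoid as CMSolver
open import Algebra.Structures using (IsGroup; IsAbelianGroup)
open import Function using (_∘_)
open import Level using (0ℓ)
open import Relation.Binary.Definitions using (DecidableEquality)
open import Relation.Binary.PropositionalEquality hiding (J)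
open import Relation.Nullary
open import Relation.Nullary.Decidable using (_⊎-dec_; _×-dec_; dec-true; dec-false)
open import Relation.Nullary.Negation using (contradiction)
open import Relation.Unary using (Pred; Decidable)
open +-*-Solver using (solve; _:+_; _:*_; _:=_; con)

-- Counting in lists

-- `R` is a relation rather than a function so that a count can be transferred from mere witnesses;
-- it only has to determine `x` from `y`.
inj-≤ : {X Y : Set} (R : X → Y → Set) {xs : List X} {ys : List Y} → Unique xs →
        (∀ {x} → x ∈ xs → ∃ λ y → y ∈ ys × R x y) →
        (∀ {x x′ y} → R x y → R x′ y → x ≡ x′) →
        length xs ≤ length ys
inj-≤ R {[]} _ f inj = z≤n
inj-≤ R {x ∷ xs} (x∉ ∷ u) f inj with f (here refl)
... | y , y∈ , r with ∈-∃++ y∈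
... | ys₁ , ys₂ , refl = ≤-trans (s≤s (inj-≤ R u f′ inj)) (≤-reflexive len)
  where
  len : suc (length (ys₁ ++ ys₂)) ≡ length (ys₁ ++ y ∷ ys₂)
  len = trans (cong suc (length-++ ys₁))
       (trans (sym (+-suc (length ys₁) (length ys₂))) (sym (length-++ ys₁)))
  f′ : ∀ {z} → z ∈ xs → ∃ λ w → w ∈ ys₁ ++ ys₂ × R z w
  f′ z∈ with f (there z∈)
  ... | w , w∈ , s with ∈-++⁻ ys₁ w∈
  ... | inj₁ w∈₁ = w , ∈-++⁺ˡ w∈₁ , s
  ... | inj₂ (there w∈₂) = w , ∈-++⁺ʳ ys₁ w∈₂ , s
  ... | inj₂ (here refl) = ⊥-elim (All.lookup x∉ z∈ (inj r s))

⊆⇒length≤ : {X : Set} {xs ys : List X} → Unique xs → (∀ {x} → x ∈ xs → x ∈ ys) →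
            length xs ≤ length ys
⊆⇒length≤ u sub = inj-≤ _≡_ u (λ {x} x∈ → x , sub x∈ , refl) (λ p q → trans p (sym q))

length-cartesianProductWith : {X Y Z : Set} (f : X → Y → Z) (xs : List X) (ys : List Y) →
                              length (cartesianProductWith f xs ys) ≡ length xs * length ys
length-cartesianProductWith f [] ys = refl
length-cartesianProductWith f (x ∷ xs) ys =
  trans (length-++ (map (f x) ys)) (cong₂ _+_ (length-map (f x) ys) (length-cartesianProductWith f xs ys))

module _ {X : Set} where

  cnt : {P : Pred X 0ℓ} → Decidable P → List X → ℕ
  cnt P? xs = length (filter P? xs)

  cnt-∷ : {P : Pred X 0ℓ} (P? : Decidable P) (x : X) (xs : List X) →
          cnt P? (x ∷ xs) ≡ cnt P? (x ∷ []) + cnt P? xs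
  cnt-∷ P? x xs with does (P? x)
  ... | true  = refl
  ... | false = refl

  cnt-∁ : {P : Pred X 0ℓ} (P? : Decidable P) (xs : List X) →
          cnt P? xs + cnt (¬? ∘ P?) xs ≡ length xs
  cnt-∁ P? [] = refl
  cnt-∁ P? (x ∷ xs) with does (P? x)
  ... | true  = cong suc (cnt-∁ P? xs)
  ... | false = trans (+-suc _ _) (cong suc (cnt-∁ P? xs))

  Σ[_] : (X → ℕ) → List X → ℕ
  Σ[ f ] xs = sum (map f xs)

  Σ-lower : {f : X → ℕ} {c : ℕ} (xs : List X) → (∀ {x} → x ∈ xs → c ≤ f x) →
            length xs * c ≤ Σ[ f ] xs
  Σ-lower [] h = z≤n
  Σ-lower (x ∷ xs) h = +-mono-≤ (h (here refl)) (Σ-lower xs (h ∘ there))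

  Σ-upper : {f : X → ℕ} {c : ℕ} (xs : List X) → (∀ {x} → x ∈ xs → f x ≤ c) →
            Σ[ f ] xs ≤ length xs * c
  Σ-upper [] h = z≤n
  Σ-upper (x ∷ xs) h = +-mono-≤ (h (here refl)) (Σ-upper xs (h ∘ there))

  Σ-+ : (f g : X → ℕ) (xs : List X) → Σ[ (λ x → f x + g x) ] xs ≡ Σ[ f ] xs + Σ[ g ] xs
  Σ-+ f g [] = refl
  Σ-+ f g (x ∷ xs) rewrite Σ-+ f g xs =
    solve 4 (λ a b c d → a :+ b :+ (c :+ d) := a :+ c :+ (b :+ d)) refl (f x) (g x) (Σ[ f ] xs) (Σ[ g ] xs)

  Σ-cong : {f g : X → ℕ} (xs : List X) → (∀ x → f x ≡ g x) → Σ[ f ] xs ≡ Σ[ g ] xs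
  Σ-cong [] h = refl
  Σ-cong (x ∷ xs) h = cong₂ _+_ (h x) (Σ-cong xs h)

  Σ-0 : (xs : List X) → Σ[ (λ _ → 0) ] xs ≡ 0
  Σ-0 [] = refl
  Σ-0 (x ∷ xs) = Σ-0 xs

module _ {X Y : Set} {R : X → Y → Set} (R? : ∀ x y → Dec (R x y)) where

  cnt-as-Σ : (x : X) (ys : List Y) → cnt (R? x) ys ≡ Σ[ (λ y → cnt (λ x → R? x y) (x ∷ [])) ] ys
  cnt-as-Σ x [] = refl
  cnt-as-Σ x (y ∷ ys) with ih ← cnt-as-Σ x ys | does (R? x y)
  ... | true  = cong suc ih
  ... | false = ih

  Σ-swap : (xs : List X) (ys : List Y) →
           Σ[ (λ x → cnt (R? x) ys) ] xs ≡ Σ[ (λ y → cnt (λ x → R? x y) xs) ] ys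
  Σ-swap [] ys = sym (Σ-0 ys)
  Σ-swap (x ∷ xs) ys = begin
    cnt (R? x) ys + Σ[ (λ x → cnt (R? x) ys) ] xs
      ≡⟨ cong₂ _+_ (cnt-as-Σ x ys) (Σ-swap xs ys) ⟩
    Σ[ (λ y → cnt (λ x → R? x y) (x ∷ [])) ] ys + Σ[ (λ y → cnt (λ x → R? x y) xs) ] ys
      ≡⟨ sym (Σ-+ _ _ ys) ⟩
    Σ[ (λ y → cnt (λ x → R? x y) (x ∷ []) + cnt (λ x → R? x y) xs) ] ys
      ≡⟨ Σ-cong ys (λ y → sym (cnt-∷ (λ x → R? x y) x xs)) ⟩
    Σ[ (λ y → cnt (λ x → R? x y) (x ∷ xs)) ] ys ∎
    where open ≡-Reasoning

  double-count : (xs : List X) (ys : List Y) {c d : ℕ} →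
                 (∀ {x} → x ∈ xs → c ≤ cnt (R? x) ys) →
                 (∀ {y} → y ∈ ys → cnt (λ x → R? x y) xs ≤ d) →
                 length xs * c ≤ length ys * d
  double-count xs ys lo hi =
    ≤-trans (Σ-lower xs lo) (≤-trans (≤-reflexive (Σ-swap xs ys)) (Σ-upper ys hi))

cnt-unique : {X : Set} {P : Pred X 0ℓ} (P? : Decidable P) {xs : List X} → Unique xs →
             (∀ {x y} → P x → P y → x ≡ y) → cnt P? xs ≤ 1
cnt-unique P? {xs} u one = inj-≤ (λ x _ → x ∈ filter P? xs) {ys = 0 ∷ []} (Unq.filter⁺ P? u)
  (λ x∈ → 0 , here refl , x∈)
  (λ x∈ y∈ → one (proj₂ (∈-filter⁻ P? {xs = xs} x∈)) (proj₂ (∈-filter⁻ P? {xs = xs} y∈)))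

-- Averaging, with the quotient kept as a product: if each `y` met fewer than
-- `length xs / length ys` of the `x`, there would be fewer than `length xs` incidences, while each
-- `x` has one.
popular : {X Y : Set} {R : X → Y → Set} (R? : ∀ x y → Dec (R x y)) {xs : List X} (ys : List Y) →
          1 ≤ length xs → (∀ {x} → x ∈ xs → ∃ λ y → y ∈ ys × R x y) →
          ∃ λ y → y ∈ ys × length xs ≤ length ys * cnt (λ x → R? x y) xs
popular {R = R} R? {xs} ys ne cover with any? (λ y → length xs ≤? length ys * cnt (λ x → R? x y) xs) ys
... | yes p = let y , y∈ , h = find p in y , y∈ , h
... | no ¬p = ⊥-elim (<-irrefl refl (begin-strict
    length xs * length ys                            ≤⟨ *-monoˡ-≤ (length ys) lower ⟩
    Σ[ c ] ys * length ys                            ≡⟨ *-comm (Σ[ c ] ys) (length ys) ⟩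
    length ys * Σ[ c ] ys                            <⟨ below (length ys) ys ys-ne (λ y∈ → ≰⇒> (λ h → ¬p (lose y∈ h))) ⟩
    length ys * length xs                            ≡⟨ *-comm (length ys) (length xs) ⟩
    length xs * length ys                            ∎))
  where
  open ≤-Reasoning
  c : _ → ℕ
  c y = cnt (λ x → R? x y) xs
  pos : ∀ {x} → x ∈ xs → 1 ≤ cnt (R? x) ys
  pos x∈ = let y , y∈ , r = cover x∈ in ∈-length (∈-filter⁺ (R? _) y∈ r)
  lower : length xs ≤ Σ[ c ] ys
  lower = begin
    length xs                     ≡⟨ sym (*-identityʳ _) ⟩
    length xs * 1                 ≤⟨ Σ-lower xs pos ⟩
    Σ[ (λ x → cnt (R? x) ys) ] xs ≡⟨ Σ-swap R? xs ys ⟩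
    Σ[ c ] ys                     ∎
  some : ∀ {zs : List _} → 1 ≤ length zs → (∀ {x} → x ∈ zs → ∃ λ y → y ∈ ys × R x y) → 1 ≤ length ys
  some {x ∷ zs} _ f = ∈-length (proj₁ (proj₂ (f (here refl))))
  ys-ne : 1 ≤ length ys
  ys-ne = some ne cover
  below : ∀ l (zs : List _) → 1 ≤ length zs → (∀ {y} → y ∈ zs → l * c y < length xs) →
          l * Σ[ c ] zs < length zs * length xs
  below l (z ∷ []) _ h = subst₂ _<_ (cong (l *_) (sym (+-identityʳ (c z)))) (sym (+-identityʳ _)) (h (here refl))
  below l (z ∷ zs@(_ ∷ _)) _ h = subst (_< length xs + length zs * length xs) (sym (*-distribˡ-+ l (c z) (Σ[ c ] zs)))
    (+-mono-< (h (here refl)) (below l zs (s≤s z≤n) (h ∘ there)))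

-- Greedy covering: keep adding a v whose row contributes at least θ new values.

module Greedy {V I U : Set} (_≟_ : DecidableEquality U) (s : V → I → U)
              (s-inj : ∀ v {a b} → s v a ≡ s v b → a ≡ b)
              (is : List I) (is! : Unique is) (us : List U) (us! : Unique us)
              (cand : List V) (s∈us : ∀ {v a} → v ∈ cand → a ∈ is → s v a ∈ us)
              (θ : ℕ) (0<θ : 1 ≤ θ) where

  Covered : List V → U → Set
  Covered bs u = Any (λ b → Any (λ a → s b a ≡ u) is) bs

  covered? : ∀ bs → Decidable (Covered bs)
  covered? bs u = any? (λ b → any? (λ a → s b a ≟ u) is) bs

  new : List V → V → ℕ
  new bs v = cnt (λ a → ¬? (covered? bs (s v a))) is

  Result : Set
  Result = ∃ λ bs → (∀ {b} → b ∈ bs → b ∈ cand) × length bs * θ ≤ length us ×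
                    (∀ {v} → v ∈ cand → new bs v < θ)

  grow : ∀ bs {v} → v ∈ cand → new bs v + cnt (covered? bs) us ≤ cnt (covered? (v ∷ bs)) us
  grow bs {v} v∈ = begin
    new bs v + cnt (covered? bs) us
      ≡⟨ cong (_+ cnt (covered? bs) us) (sym (length-map (s v) fresh)) ⟩
    length (map (s v) fresh) + cnt (covered? bs) us
      ≡⟨ sym (length-++ (map (s v) fresh)) ⟩
    length (map (s v) fresh ++ filter (covered? bs) us)
      ≤⟨ ⊆⇒length≤ (Unq.++⁺ (Unq.map⁺ (s-inj v) (Unq.filter⁺ _ is!)) (Unq.filter⁺ (covered? bs) us!) disj) sub ⟩
    cnt (covered? (v ∷ bs)) us ∎
    where
    open ≤-Reasoning
    fresh = filter (λ a → ¬? (covered? bs (s v a))) is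
    disj : ∀ {u} → ¬ (u ∈ map (s v) fresh × u ∈ filter (covered? bs) us)
    disj (u∈₁ , u∈₂) with ∈-map⁻ (s v) u∈₁
    ... | a , a∈ , refl = proj₂ (∈-filter⁻ (λ a → ¬? (covered? bs (s v a))) {xs = is} a∈)
                                (proj₂ (∈-filter⁻ (covered? bs) {xs = us} u∈₂))
    sub : ∀ {u} → u ∈ map (s v) fresh ++ filter (covered? bs) us → u ∈ filter (covered? (v ∷ bs)) us
    sub u∈ with ∈-++⁻ (map (s v) fresh) u∈
    ... | inj₂ u∈₂ = let u∈us , c = ∈-filter⁻ (covered? bs) {xs = us} u∈₂ in
                     ∈-filter⁺ (covered? (v ∷ bs)) u∈us (there c)
    ... | inj₁ u∈₁ with ∈-map⁻ (s v) u∈₁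
    ... | a , a∈ , refl = let a∈is , _ = ∈-filter⁻ (λ a → ¬? (covered? bs (s v a))) {xs = is} a∈ in
                     ∈-filter⁺ (covered? (v ∷ bs)) (s∈us v∈ a∈is) (here (lose a∈is refl))

  -- Every round covers at least `θ ≥ 1` new elements of `us`, so `bs` cannot outgrow `us` and the
  -- fuel never runs out before the search stops.
  search : (fuel : ℕ) (bs : List V) → (∀ {b} → b ∈ bs → b ∈ cand) →
           length bs * θ ≤ cnt (covered? bs) us → length us < fuel + length bs → Result
  search fuel bs bs⊆ inv lt with any? (λ v → θ ≤? new bs v) cand
  ... | no none = bs , bs⊆ , ≤-trans inv (length-filter (covered? bs) us) ,
                  λ v∈ → ≰⇒> (λ h → none (lose v∈ h))
  search zero bs bs⊆ inv lt | yes _ = ⊥-elim (<-irrefl refl (begin-strict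
    length us             <⟨ lt ⟩
    length bs             ≡⟨ sym (*-identityʳ _) ⟩
    length bs * 1         ≤⟨ *-monoʳ-≤ (length bs) 0<θ ⟩
    length bs * θ         ≤⟨ inv ⟩
    cnt (covered? bs) us  ≤⟨ length-filter (covered? bs) us ⟩
    length us             ∎))
    where open ≤-Reasoning
  search (suc fuel) bs bs⊆ inv lt | yes p =
    let v , v∈ , h = find p in
    search fuel (v ∷ bs) (λ { (here refl) → v∈ ; (there b∈) → bs⊆ b∈ })
      (≤-trans (+-mono-≤ h inv) (grow bs v∈))
      (subst (length us <_) (sym (+-suc fuel (length bs))) lt)

  greedy : Result
  greedy = search (suc (length us)) [] (λ ()) z≤n (m≤m+n (suc (length us)) 0)

pigeonhole : {X Y : Set} (_≟_ : DecidableEquality Y) (f : X → Y) {xs : List X} {ys : List Y} →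
             Unique xs → (∀ {x} → x ∈ xs → f x ∈ ys) → length ys < length xs →
             ∃₂ λ x x′ → x ∈ xs × x′ ∈ xs × x ≢ x′ × f x ≡ f x′
pigeonhole _≟_ f {xs} {ys} u f∈ lt with collide xs u
  where
  collide : ∀ zs → Unique zs →
            (∃₂ λ x x′ → x ∈ zs × x′ ∈ zs × x ≢ x′ × f x ≡ f x′) ⊎ AllPairs (λ x y → f x ≢ f y) zs
  collide [] [] = inj₂ []
  collide (z ∷ zs) (z∉ ∷ u) with any? (λ y → f z ≟ f y) zs | collide zs u
  ... | yes p | _ = let y , y∈ , eq = find p in inj₁ (z , y , here refl , there y∈ , All.lookup z∉ y∈ , eq)
  ... | no _  | inj₁ (x , x′ , x∈ , x′∈ , rest) = inj₁ (x , x′ , there x∈ , there x′∈ , rest)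
  ... | no ¬p | inj₂ ps = inj₂ (All.tabulate (λ y∈ eq → ¬p (lose y∈ eq)) ∷ ps)
... | inj₁ r  = r
... | inj₂ ps = contradiction (≤-<-trans le lt) (<-irrefl refl)
  where
  le : length xs ≤ length ys
  le = subst (_≤ length ys) (length-map f xs)
         (⊆⇒length≤ (AllPairsₚ.map⁺ ps) λ y∈ → let x , x∈ , eq = ∈-map⁻ f y∈ in subst (_∈ ys) (sym eq) (f∈ x∈))

-- Quotient sets of dilates in an abelian group

module Dilates {X : Set} (_≟_ : DecidableEquality X) {_∙_ : X → X → X} {ε : X} {_⁻¹ : X → X}
               (isAbelianGroup : IsAbelianGroup _≡_ _∙_ ε _⁻¹)
               (D : List X) (D! : Unique D) (1≤D : 1 ≤ length D)
               (Qt : List X) (Qt! : Unique Qt) (D/D⊆ : ∀ {a b} → a ∈ D → b ∈ D → (a ∙ (b ⁻¹)) ∈ Qt)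
               where

  open IsAbelianGroup isAbelianGroup using (assoc; identityˡ; identityʳ; inverseˡ; inverseʳ)

  private
    Ab : AbelianGroup _ _
    Ab = record { isAbelianGroup = isAbelianGroup }

  open AbelianGroup Ab using (group; commutativeMonoid)
  open AbelianGroupₚ Ab using (⁻¹-∙-comm)
  open Groupₚ group using (⁻¹-injective; ∙-cancelˡ; ∙-cancelʳ)
  open CMSolver commutativeMonoid using (_⊕_; _⊜_) renaming (solve to cm-solve)

  pow : X → ℕ → X
  pow a zero    = ε
  pow a (suc k) = pow a k ∙ a

  pow-quot : ∀ a b k → pow (a ∙ (b ⁻¹)) k ≡ pow a k ∙ (pow b k ⁻¹)
  pow-quot a b zero = sym (inverseʳ ε)
  pow-quot a b (suc k) = begin
    pow (a ∙ (b ⁻¹)) k ∙ (a ∙ (b ⁻¹))           ≡⟨ cong (_∙ _) (pow-quot a b k) ⟩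
    (pow a k ∙ (pow b k ⁻¹)) ∙ (a ∙ (b ⁻¹))     ≡⟨ cm-solve 4 (λ p q x y → (p ⊕ q) ⊕ (x ⊕ y) ⊜ (p ⊕ x) ⊕ (q ⊕ y)) refl (pow a k) (pow b k ⁻¹) a (b ⁻¹) ⟩
    (pow a k ∙ a) ∙ ((pow b k ⁻¹) ∙ (b ⁻¹))     ≡⟨ cong ((pow a k ∙ a) ∙_) (⁻¹-∙-comm (pow b k) b) ⟩
    (pow a k ∙ a) ∙ ((pow b k ∙ b) ⁻¹)          ∎
    where open ≡-Reasoning

  quot-eq : ∀ {x y p r} → x ∙ (p ⁻¹) ≡ y ∙ (r ⁻¹) → x ∙ (y ⁻¹) ≡ p ∙ (r ⁻¹)
  quot-eq {x} {y} {p} {r} eq = begin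
    x ∙ (y ⁻¹)                        ≡⟨ cong (_∙ (y ⁻¹)) (sym (trans (assoc x (p ⁻¹) p) (trans (cong (x ∙_) (inverseˡ p)) (identityʳ x)))) ⟩
    ((x ∙ (p ⁻¹)) ∙ p) ∙ (y ⁻¹)       ≡⟨ cong (λ z → (z ∙ p) ∙ (y ⁻¹)) eq ⟩
    ((y ∙ (r ⁻¹)) ∙ p) ∙ (y ⁻¹)       ≡⟨ cm-solve 4 (λ y r p y′ → ((y ⊕ r) ⊕ p) ⊕ y′ ⊜ (p ⊕ r) ⊕ (y ⊕ y′)) refl y (r ⁻¹) p (y ⁻¹) ⟩
    (p ∙ (r ⁻¹)) ∙ (y ∙ (y ⁻¹))       ≡⟨ cong ((p ∙ (r ⁻¹)) ∙_) (inverseʳ y) ⟩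
    (p ∙ (r ⁻¹)) ∙ ε                  ≡⟨ identityʳ _ ⟩
    p ∙ (r ⁻¹)                        ∎
    where open ≡-Reasoning

  d = length D
  T = length Qt
  θ = ⌈ d /2⌉

  open Greedy _≟_ (λ v a → v ∙ (a ⁻¹)) (λ v eq → ⁻¹-injective (∙-cancelˡ v _ _ eq))
              D D! Qt Qt! D D/D⊆ θ (⌈n/2⌉-mono 1≤D)

  B = proj₁ greedy
  Bθ≤T : length B * θ ≤ T
  Bθ≤T = proj₁ (proj₂ (proj₂ greedy))

  -- The search stops with fewer than `θ` uncovered `a`. As `θ` is half of `d` rounded up, at least
  -- `⌊ d /2⌋ + 1 ≥ θ` are covered.
  good≥θ : ∀ {w} → w ∈ D → θ ≤ cnt (λ a → covered? B (w ∙ (a ⁻¹))) D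
  good≥θ {w} w∈ = ≤-trans θ≤ (+-cancelʳ-≤ _ _ _ (begin
      suc ⌊ d /2⌋ + new B w       ≡⟨ sym (+-suc ⌊ d /2⌋ (new B w)) ⟩
      ⌊ d /2⌋ + suc (new B w)     ≤⟨ +-monoʳ-≤ ⌊ d /2⌋ (proj₂ (proj₂ (proj₂ greedy)) w∈) ⟩
      ⌊ d /2⌋ + θ                 ≡⟨ ⌊n/2⌋+⌈n/2⌉≡n d ⟩
      d                           ≡⟨ sym (cnt-∁ (λ a → covered? B (w ∙ (a ⁻¹))) D) ⟩
      cnt (λ a → covered? B (w ∙ (a ⁻¹))) D + new B w ∎))
    where
    open ≤-Reasoning
    θ≤ : θ ≤ suc ⌊ d /2⌋
    θ≤ = ⌊n/2⌋-mono (n≤1+n (suc d))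

  _·D : List X → List X
  P ·D = cartesianProductWith _∙_ P D

  Q : List X → List X
  Q P = deduplicate _≟_ (cartesianProductWith (λ x p → x ∙ (p ⁻¹)) D P)

  Q! : ∀ P → Unique (Q P)
  Q! P = UnqDec.deduplicate-! _≟_ _

  ∈-Q : ∀ {P x p} → x ∈ D → p ∈ P → (x ∙ (p ⁻¹)) ∈ Q P
  ∈-Q x∈ p∈ = ∈-deduplicate⁺ _≟_ (∈-cartesianProductWith⁺ _ x∈ p∈)

  Triple : Set
  Triple = X × X × X

  R : X → Triple → Set
  R z (u , t , b) = (u ∙ t) ∙ (b ⁻¹) ≡ z

  R? : ∀ z t → Dec (R z t)
  R? z (u , t , b) = ((u ∙ t) ∙ (b ⁻¹)) ≟ z

  -- Additively `x - p - v - w = (x - p - a) + (a′ - v) - b`, because `w = b + a -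
  -- a′`. A quotient by `P + 2D` is thereby traded for one by `P + D`, an element of `D -
  -- D` and an element of `B`.
  rearrange : ∀ x p v w a a′ b → b ∙ (a′ ⁻¹) ≡ w ∙ (a ⁻¹) →
              R (x ∙ (((p ∙ v) ∙ w) ⁻¹)) (x ∙ ((p ∙ a) ⁻¹) , a′ ∙ (v ⁻¹) , b)
  rearrange x p v w a a′ b eq = begin
    ((x ∙ ((p ∙ a) ⁻¹)) ∙ (a′ ∙ (v ⁻¹))) ∙ (b ⁻¹)
      ≡⟨ cong₂ (λ r s → ((x ∙ r) ∙ (s ∙ (v ⁻¹))) ∙ (b ⁻¹)) (sym (⁻¹-∙-comm p a)) a′≡ ⟩
    ((x ∙ ((p ⁻¹) ∙ (a ⁻¹))) ∙ ((b ∙ (a ∙ (w ⁻¹))) ∙ (v ⁻¹))) ∙ (b ⁻¹)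
      ≡⟨ cm-solve 8 (λ x p a′ b a w v b′ → ((x ⊕ (p ⊕ a′)) ⊕ ((b ⊕ (a ⊕ w)) ⊕ v)) ⊕ b′
                        ⊜ ((x ⊕ ((p ⊕ v) ⊕ w)) ⊕ (a ⊕ a′)) ⊕ (b ⊕ b′)) refl
                  x (p ⁻¹) (a ⁻¹) b a (w ⁻¹) (v ⁻¹) (b ⁻¹) ⟩
    ((x ∙ (((p ⁻¹) ∙ (v ⁻¹)) ∙ (w ⁻¹))) ∙ (a ∙ (a ⁻¹))) ∙ (b ∙ (b ⁻¹))
      ≡⟨ cong₂ (λ r s → ((x ∙ (((p ⁻¹) ∙ (v ⁻¹)) ∙ (w ⁻¹))) ∙ r) ∙ s) (inverseʳ a) (inverseʳ b) ⟩
    ((x ∙ (((p ⁻¹) ∙ (v ⁻¹)) ∙ (w ⁻¹))) ∙ ε) ∙ ε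
      ≡⟨ trans (identityʳ _) (identityʳ _) ⟩
    x ∙ (((p ⁻¹) ∙ (v ⁻¹)) ∙ (w ⁻¹))
      ≡⟨ cong (x ∙_) (trans (cong (_∙ (w ⁻¹)) (⁻¹-∙-comm p v)) (⁻¹-∙-comm (p ∙ v) w)) ⟩
    x ∙ (((p ∙ v) ∙ w) ⁻¹) ∎
    where
    open ≡-Reasoning
    open Groupₚ group using (⁻¹-anti-homo-∙; ⁻¹-involutive)
    a′≡ : a′ ≡ b ∙ (a ∙ (w ⁻¹))
    a′≡ = begin
      a′                         ≡⟨ sym (identityˡ a′) ⟩
      ε ∙ a′                     ≡⟨ cong (_∙ a′) (sym (inverseʳ b)) ⟩
      (b ∙ (b ⁻¹)) ∙ a′          ≡⟨ assoc _ _ _ ⟩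
      b ∙ ((b ⁻¹) ∙ a′)          ≡⟨ cong (b ∙_) (cong ((b ⁻¹) ∙_) (sym (⁻¹-involutive a′))) ⟩
      b ∙ ((b ⁻¹) ∙ ((a′ ⁻¹) ⁻¹)) ≡⟨ cong (b ∙_) (⁻¹-∙-comm b (a′ ⁻¹)) ⟩
      b ∙ ((b ∙ (a′ ⁻¹)) ⁻¹)     ≡⟨ cong (λ z → b ∙ (z ⁻¹)) eq ⟩
      b ∙ ((w ∙ (a ⁻¹)) ⁻¹)      ≡⟨ cong (b ∙_) (⁻¹-anti-homo-∙ w (a ⁻¹)) ⟩
      b ∙ (((a ⁻¹) ⁻¹) ∙ (w ⁻¹)) ≡⟨ cong (λ z → b ∙ (z ∙ (w ⁻¹))) (⁻¹-involutive a) ⟩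
      b ∙ (a ∙ (w ⁻¹))           ∎

  -- Every w⁻¹ equals a′ a⁻¹ b⁻¹ for at least half of the a ∈ D, so each quotient counted on the
  -- left has at least θ decompositions; this replaces Plünnecke's inequality.
  Q-grow₀ : ∀ P → length (Q ((P ·D) ·D)) * θ ≤ length (Q (P ·D)) * (T * length B)
  Q-grow₀ P = begin
    length (Q ((P ·D) ·D)) * θ          ≤⟨ double-count R? (Q ((P ·D) ·D)) triples lo hi ⟩
    length triples * 1                  ≡⟨ *-identityʳ _ ⟩
    length triples                      ≡⟨ length-cartesianProductWith _,_ (Q (P ·D)) (cartesianProduct Qt B) ⟩
    length (Q (P ·D)) * length (cartesianProduct Qt B) ≡⟨ cong (length (Q (P ·D)) *_) (length-cartesianProductWith _,_ Qt B) ⟩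
    length (Q (P ·D)) * (T * length B)  ∎
    where
    open ≤-Reasoning
    triples : List Triple
    triples = cartesianProduct (Q (P ·D)) (cartesianProduct Qt B)
    hi : ∀ {t} → t ∈ triples → cnt (λ z → R? z t) (Q ((P ·D) ·D)) ≤ 1
    hi {t} _ = cnt-unique (λ z → R? z t) (Q! ((P ·D) ·D)) (λ r s → trans (sym r) s)
    lo : ∀ {z} → z ∈ Q ((P ·D) ·D) → θ ≤ cnt (R? z) triples
    lo {z} z∈ with ∈-cartesianProductWith⁻ _ D ((P ·D) ·D) (∈-deduplicate⁻ _≟_ (cartesianProductWith _ D ((P ·D) ·D)) z∈)
    ... | x , _ , x∈ , pvw∈ , refl with ∈-cartesianProductWith⁻ _∙_ (P ·D) D pvw∈
    ... | _ , w , pv∈ , w∈ , refl with ∈-cartesianProductWith⁻ _∙_ P D pv∈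
    ... | p , v , p∈ , v∈ , refl = ≤-trans (good≥θ w∈)
        -- `x` and `p` are fixed, so the first coordinate of the triple determines `a`: the good `a`
        -- give distinct decompositions.
        (inj-≤ (λ a t → proj₁ t ≡ x ∙ ((p ∙ a) ⁻¹)) (Unq.filter⁺ _ D!) image
          (λ e e′ → ∙-cancelˡ p _ _ (⁻¹-injective (∙-cancelˡ x _ _ (trans (sym e) e′)))))
      where
      image : ∀ {a} → a ∈ filter (λ a → covered? B (w ∙ (a ⁻¹))) D →
              ∃ λ t → t ∈ filter (R? (x ∙ (((p ∙ v) ∙ w) ⁻¹))) triples × proj₁ t ≡ x ∙ ((p ∙ a) ⁻¹)
      image {a} a∈ with ∈-filter⁻ (λ a → covered? B (w ∙ (a ⁻¹))) {xs = D} a∈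
      ... | a∈D , cov with find cov
      ... | b , b∈ , cov′ with find cov′
      ... | a′ , a′∈ , eq = _ , ∈-filter⁺ (R? _)
              (∈-cartesianProduct⁺ (∈-Q x∈ (∈-cartesianProductWith⁺ _∙_ p∈ a∈D))
                                   (∈-cartesianProduct⁺ (D/D⊆ a′∈ v∈) b∈))
              (rearrange x p v w a a′ b eq) , refl

  -- The cover satisfies `length B ≤ T / θ`, and `d ≤ 2 θ`; each extra summand `D` thus costs a
  -- factor `T length B / θ ≤ 4 T² / d²`.
  Q-grow : ∀ P → length (Q ((P ·D) ·D)) * (d * d) ≤ (4 * (T * T)) * length (Q (P ·D))
  Q-grow P = begin
    l * (d * d)               ≤⟨ *-monoʳ-≤ l (*-mono-≤ d≤2θ d≤2θ) ⟩
    l * ((θ + θ) * (θ + θ))   ≡⟨ solve 2 (λ l t → l :* ((t :+ t) :* (t :+ t)) := con 4 :* (l :* t) :* t) refl l θ ⟩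
    4 * (l * θ) * θ           ≤⟨ *-monoˡ-≤ θ (*-monoʳ-≤ 4 (Q-grow₀ P)) ⟩
    4 * (r * (T * length B)) * θ ≡⟨ solve 4 (λ r t b u → con 4 :* (r :* (t :* b)) :* u := con 4 :* (t :* (b :* u)) :* r) refl r T (length B) θ ⟩
    4 * (T * (length B * θ)) * r ≤⟨ *-monoˡ-≤ r (*-monoʳ-≤ 4 (*-monoʳ-≤ T Bθ≤T)) ⟩
    4 * (T * T) * r ∎
    where
    open ≤-Reasoning
    l = length (Q ((P ·D) ·D))
    r = length (Q (P ·D))
    d≤2θ : d ≤ θ + θ
    d≤2θ = ≤-trans (≤-reflexive (sym (⌊n/2⌋+⌈n/2⌉≡n d))) (+-monoˡ-≤ θ (⌊n/2⌋≤⌈n/2⌉ d))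

  D^ : ℕ → List X
  D^ zero    = ε ∷ []
  D^ (suc k) = D^ k ·D

  pow∈D^ : ∀ {a} k → a ∈ D → pow a k ∈ D^ k
  pow∈D^ zero    a∈ = here refl
  pow∈D^ (suc k) a∈ = ∈-cartesianProductWith⁺ _∙_ (pow∈D^ k a∈) a∈

  Q-bound : ∀ k → length (Q (D^ (suc k))) * (d * d) ^ k ≤ (4 * (T * T)) ^ k * T
  Q-bound zero = begin
    length (Q (D^ 1)) * 1 ≡⟨ *-identityʳ _ ⟩
    length (Q (D^ 1))     ≤⟨ ⊆⇒length≤ (Q! (D^ 1)) sub ⟩
    T                     ≡⟨ sym (+-identityʳ T) ⟩
    1 * T                 ∎
    where
    open ≤-Reasoning
    sub : ∀ {z} → z ∈ Q (D^ 1) → z ∈ Qt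
    sub z∈ with ∈-cartesianProductWith⁻ _ D (D^ 1) (∈-deduplicate⁻ _≟_ (cartesianProductWith _ D (D^ 1)) z∈)
    ... | x , _ , x∈ , e∈ , refl with ∈-cartesianProductWith⁻ _∙_ (ε ∷ []) D e∈
    ... | _ , a , here refl , a∈ , refl = subst (λ z → (x ∙ (z ⁻¹)) ∈ Qt) (sym (identityˡ a)) (D/D⊆ x∈ a∈)
  Q-bound (suc k) = begin
    l′ * (d * d * (d * d) ^ k)             ≡⟨ sym (*-assoc l′ (d * d) _) ⟩
    l′ * (d * d) * (d * d) ^ k             ≤⟨ *-monoˡ-≤ ((d * d) ^ k) (Q-grow (D^ k)) ⟩
    4 * (T * T) * l * (d * d) ^ k          ≡⟨ *-assoc (4 * (T * T)) l _ ⟩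
    4 * (T * T) * (l * (d * d) ^ k)        ≤⟨ *-monoʳ-≤ (4 * (T * T)) (Q-bound k) ⟩
    4 * (T * T) * ((4 * (T * T)) ^ k * T)  ≡⟨ sym (*-assoc (4 * (T * T)) _ T) ⟩
    4 * (T * T) * (4 * (T * T)) ^ k * T    ∎
    where
    open ≤-Reasoning
    l′ = length (Q (D^ (suc (suc k))))
    l  = length (Q (D^ (suc k)))

  IsQuotient : X → Set
  IsQuotient z = ∃₂ λ x y → x ∈ D × y ∈ D × x ∙ (y ⁻¹) ≡ z

  DyadicQuotients : Set
  DyadicQuotients = ∃₂ λ a b → a ∈ D × b ∈ D × a ≢ b ×
    IsQuotient (pow (a ∙ (b ⁻¹)) 2) × IsQuotient (pow (a ∙ (b ⁻¹)) 4) × IsQuotient (pow (a ∙ (b ⁻¹)) 8)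

  -- A collision of `f` gives `x a⁻² = y b⁻²`, that is `x y⁻¹ = (a b⁻¹)²`, and likewise for 4 and 8.
  -- The exponent 11 = 1 + 3 + 7 adds those of `Q-bound` for `D^ 2`, `D^ 4` and `D^ 8`; the
  -- hypothesis amounts to `4^11 T^25 < d^26`.
  dyadic-quotients : (4 * (T * T)) ^ 11 * T ^ 3 < d ^ 4 * (d * d) ^ 11 → DyadicQuotients
  dyadic-quotients lt = extract (pigeonhole (≡-dec _≟_ (≡-dec _≟_ _≟_)) f
      (Unq.cartesianProduct⁺ D! (Unq.cartesianProduct⁺ D! (Unq.cartesianProduct⁺ D! D!))) f∈ few)
    where
    tuples : List (X × X × X × X)
    tuples = cartesianProduct D (cartesianProduct D (cartesianProduct D D))
    targets : List (X × X × X)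
    targets = cartesianProduct (Q (D^ 2)) (cartesianProduct (Q (D^ 4)) (Q (D^ 8)))
    f : X × X × X × X → X × X × X
    f (x , x′ , x″ , a) = x ∙ (pow a 2 ⁻¹) , x′ ∙ (pow a 4 ⁻¹) , x″ ∙ (pow a 8 ⁻¹)
    unpack : ∀ {x x′ x″ a} → (x , x′ , x″ , a) ∈ tuples → x ∈ D × x′ ∈ D × x″ ∈ D × a ∈ D
    unpack t∈ =
      let x∈ , r = ∈-cartesianProduct⁻ D _ t∈
          x′∈ , r′ = ∈-cartesianProduct⁻ D _ r
          x″∈ , a∈ = ∈-cartesianProduct⁻ D D r′
      in x∈ , x′∈ , x″∈ , a∈
    f∈ : ∀ {t} → t ∈ tuples → f t ∈ targets
    f∈ t∈ = let x∈ , x′∈ , x″∈ , a∈ = unpack t∈ in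
      ∈-cartesianProduct⁺ (∈-Q x∈ (pow∈D^ 2 a∈))
        (∈-cartesianProduct⁺ (∈-Q x′∈ (pow∈D^ 4 a∈)) (∈-Q x″∈ (pow∈D^ 8 a∈)))
    l₂ = length (Q (D^ 2))
    l₄ = length (Q (D^ 4))
    l₈ = length (Q (D^ 8))
    len-targets : length targets ≡ l₂ * (l₄ * l₈)
    len-targets = trans (length-cartesianProductWith _,_ (Q (D^ 2)) _)
                        (cong (l₂ *_) (length-cartesianProductWith _,_ (Q (D^ 4)) (Q (D^ 8))))
    len-tuples : length tuples ≡ d ^ 4
    len-tuples = trans (length-cartesianProductWith _,_ D _) (cong (d *_)
                (trans (length-cartesianProductWith _,_ D _) (cong (d *_)
                (trans (length-cartesianProductWith _,_ D D) (cong (d *_) (sym (*-identityʳ d)))))))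
    E = d * d
    F = 4 * (T * T)
    few : length targets < length tuples
    few = *-cancelʳ-< _ _ _ (begin-strict
      length targets * E ^ 11            ≡⟨ cong (_* E ^ 11) len-targets ⟩
      l₂ * (l₄ * l₈) * E ^ 11            ≡⟨ cong (l₂ * (l₄ * l₈) *_) (^-distribˡ-+-* E 1 10) ⟩
      l₂ * (l₄ * l₈) * (E ^ 1 * E ^ 10)  ≡⟨ cong (λ z → l₂ * (l₄ * l₈) * (E ^ 1 * z)) (^-distribˡ-+-* E 3 7) ⟩
      l₂ * (l₄ * l₈) * (E ^ 1 * (E ^ 3 * E ^ 7))
        ≡⟨ solve 6 (λ a b c x y z → a :* (b :* c) :* (x :* (y :* z)) := a :* x :* (b :* y :* (c :* z))) refl l₂ l₄ l₈ (E ^ 1) (E ^ 3) (E ^ 7) ⟩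
      l₂ * E ^ 1 * (l₄ * E ^ 3 * (l₈ * E ^ 7))
        ≤⟨ *-mono-≤ (Q-bound 1) (*-mono-≤ (Q-bound 3) (Q-bound 7)) ⟩
      F ^ 1 * T * (F ^ 3 * T * (F ^ 7 * T))
        ≡⟨ solve 4 (λ x y z t → x :* t :* (y :* t :* (z :* t)) := x :* (y :* z) :* (t :* (t :* (t :* con 1)))) refl (F ^ 1) (F ^ 3) (F ^ 7) T ⟩
      F ^ 1 * (F ^ 3 * F ^ 7) * T ^ 3    ≡⟨ cong (λ z → F ^ 1 * z * T ^ 3) (sym (^-distribˡ-+-* F 3 7)) ⟩
      F ^ 1 * F ^ 10 * T ^ 3             ≡⟨ cong (_* T ^ 3) (sym (^-distribˡ-+-* F 1 10)) ⟩
      F ^ 11 * T ^ 3                     <⟨ lt ⟩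
      d ^ 4 * E ^ 11                     ≡⟨ cong (_* E ^ 11) (sym len-tuples) ⟩
      length tuples * E ^ 11             ∎)
      where
      open ≤-Reasoning
    extract : (∃₂ λ t t′ → t ∈ tuples × t′ ∈ tuples × t ≢ t′ × f t ≡ f t′) → DyadicQuotients
    extract ((x , x′ , x″ , a) , (y , y′ , y″ , b) , t∈ , t′∈ , t≢ , eq) =
      let x∈ , x′∈ , x″∈ , a∈ = unpack t∈
          y∈ , y′∈ , y″∈ , b∈ = unpack t′∈
          e = cong proj₁ eq
          e′ = cong (proj₁ ∘ proj₂) eq
          e″ = cong (proj₂ ∘ proj₂) eq
      in a , b , a∈ , b∈ ,
         -- If `a` were `b`, the three equations would cancel and the colliding tuples would
         -- coincide.
         (λ { refl → t≢ (cong₂ _,_ (∙-cancelʳ _ _ _ e) (cong₂ _,_ (∙-cancelʳ _ _ _ e′) (cong (_, a) (∙-cancelʳ _ _ _ e″)))) }) ,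
         (x , y , x∈ , y∈ , trans (quot-eq e) (sym (pow-quot a b 2))) ,
         (x′ , y′ , x′∈ , y′∈ , trans (quot-eq e′) (sym (pow-quot a b 4))) ,
         (x″ , y″ , x″∈ , y″∈ , trans (quot-eq e″) (sym (pow-quot a b 8)))

-- Elementary inequalities, and choice along lists

*-^ : ∀ a b n → (a * b) ^ n ≡ a ^ n * b ^ n
*-^ a b zero    = refl
*-^ a b (suc n) = trans (cong (a * b *_) (*-^ a b n))
  (solve 4 (λ a b x y → a :* b :* (x :* y) := a :* x :* (b :* y)) refl a b (a ^ n) (b ^ n))

positiveʳ : ∀ a {b} → 1 ≤ a * b → 1 ≤ b
positiveʳ a {zero}  h = contradiction (≤-trans h (≤-reflexive (*-zeroʳ a))) λ ()
positiveʳ a {suc b} h = s≤s z≤n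

positiveˡ : ∀ a {b} → 1 ≤ a * b → 1 ≤ a
positiveˡ (suc a) h = s≤s z≤n

-- Bernoulli: `(1 + 1/j)^n ≥ 1 + n/j ≥ 2`. The local `pow` keeps the first two binomial terms.
2*^≤suc^ : ∀ {j n} → j ≤ n → 1 ≤ j → 2 * j ^ n ≤ suc j ^ n
2*^≤suc^ {j} {n} j≤n 1≤j = go n j≤n
  where
  open ≤-Reasoning
  pow : ∀ n → j ^ suc n + suc n * j ^ n ≤ suc j ^ suc n
  pow zero = ≤-reflexive (solve 1 (λ j → j :* con 1 :+ con 1 := con 1 :* con 1 :+ j :* con 1) refl j)
  pow (suc n) = begin
    j * (j * j ^ n) + suc (suc n) * (j * j ^ n)
      ≤⟨ m≤m+n _ (suc n * j ^ n) ⟩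
    j * (j * j ^ n) + suc (suc n) * (j * j ^ n) + suc n * j ^ n
      ≡⟨ solve 3 (λ j x n → j :* (j :* x) :+ (con 2 :+ n) :* (j :* x) :+ (con 1 :+ n) :* x
                    := (con 1 :+ j) :* (j :* x :+ (con 1 :+ n) :* x)) refl j (j ^ n) n ⟩
    suc j * (j * j ^ n + suc n * j ^ n)
      ≤⟨ *-monoʳ-≤ (suc j) (pow n) ⟩
    suc j * suc j ^ suc n ∎
  go : ∀ n → j ≤ n → 2 * j ^ n ≤ suc j ^ n
  go zero j≤0 = contradiction (≤-trans 1≤j j≤0) λ ()
  go (suc n) j≤ = begin
    2 * (j * j ^ n)             ≡⟨ solve 1 (λ x → con 2 :* x := x :+ x) refl (j * j ^ n) ⟩
    j * j ^ n + j * j ^ n       ≤⟨ +-monoʳ-≤ (j * j ^ n) (*-monoˡ-≤ (j ^ n) j≤) ⟩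
    j ^ suc n + suc n * j ^ n   ≤⟨ pow n ⟩
    suc j ^ suc n               ∎

cnt-witness : {X : Set} {P : Pred X _} (P? : Decidable P) (xs : List X) → 1 ≤ cnt P? xs →
              ∃ λ x → x ∈ xs × P x
cnt-witness P? xs 1≤ with filter P? xs in eq
... | x ∷ _ = x , ∈-filter⁻ P? (subst (x ∈_) (sym eq) (here refl))

nonempty : {X : Set} (xs : List X) → 1 ≤ length xs → ∃ (_∈ xs)
nonempty (x ∷ _) _ = x , here refl

module _ {X Y : Set} {R : X → Y → Set} where

  choose : ∀ {xs} → All (λ x → ∃ (R x)) xs → ∃ (Pointwise R xs)
  choose []             = [] , []
  choose ((y , r) ∷ ps) = let ys , rs = choose ps in y ∷ ys , r ∷ rs

  pointwise-∈ : ∀ {xs ys} → Pointwise R xs ys → ∀ {y} → y ∈ ys → ∃ λ x → x ∈ xs × R x y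
  pointwise-∈ (r ∷ rs) (here refl) = _ , here refl , r
  pointwise-∈ (r ∷ rs) (there y∈)  = let x , x∈ , s = pointwise-∈ rs y∈ in x , there x∈ , s

  pointwise-AllPairs : {S : X → X → Set} {S′ : Y → Y → Set} →
                       (∀ {x x′ y y′} → S x x′ → R x y → R x′ y′ → S′ y y′) →
                       ∀ {xs ys} → Pointwise R xs ys → AllPairs S xs → AllPairs S′ ys
  pointwise-AllPairs f [] [] = []
  pointwise-AllPairs {S} {S′} f (r ∷ rs) (a ∷ as) =
    All.tabulate (λ y∈ → let x , x∈ , s = pointwise-∈ rs y∈ in f (All.lookup a x∈) r s) ∷ pointwise-AllPairs f rs as

AllPairs-∈ : {X : Set} {R : X → X → Set} {xs : List X} → AllPairs R xs →
             AllPairs (λ x y → x ∈ xs × y ∈ xs × R x y) xs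
AllPairs-∈ [] = []
AllPairs-∈ (a ∷ as) = All.tabulate (λ y∈ → here refl , there y∈ , All.lookup a y∈) ∷
  AllPairs.map (λ (x∈ , y∈ , r) → there x∈ , there y∈ , r) (AllPairs-∈ as)

-- Group identities and words of bounded length

module GroupTheory {X : Set} (_≟_ : DecidableEquality X) {_∙_ : X → X → X} {ε : X} {_⁻¹ : X → X}
                   (isGroup : IsGroup _≡_ _∙_ ε _⁻¹) where

  open IsGroup isGroup using (assoc; identityˡ; identityʳ; inverseˡ; inverseʳ)

  private
    Gp : Group _ _
    Gp = record { isGroup = isGroup }

  open Groupₚ Gp using (⁻¹-injective; ∙-cancelˡ; ⁻¹-anti-homo-∙; ⁻¹-involutive; ε⁻¹≈ε)
  open DecMembership _≟_ using (_∈?_)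

  -- A solver for identities of groups, by free reduction.

  infixl 7 _⊗_

  data Expr (n : ℕ) : Set where
    var : Fin n → Expr n
    _⊗_ : Expr n → Expr n → Expr n
    inv : Expr n → Expr n

  Letter : ℕ → Set
  Letter n = Bool × Fin n

  module _ {n : ℕ} where

    push : Letter n → List (Letter n) → List (Letter n)
    push l [] = l ∷ []
    push (s , i) ((t , j) ∷ ls) with ≡-dec Boolₚ._≟_ Finₚ._≟_ (not s , i) (t , j)
    ... | yes _ = ls
    ... | no _  = (s , i) ∷ (t , j) ∷ ls

    -- `k` is the already reduced remainder of the word, and `s` the sign under which `e` is read:
    -- under `false` a product is traversed backwards.
    flatten : Bool → Expr n → List (Letter n) → List (Letter n)
    flatten s     (var i) k = push (s , i) k
    flatten true  (e ⊗ f) k = flatten true e (flatten true f k)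
    flatten false (e ⊗ f) k = flatten false f (flatten false e k)
    flatten s     (inv e) k = flatten (not s) e k

    module _ (ρ : Vec X n) where

      ⟦_⟧ : Expr n → X
      ⟦ var i ⟧ = Vec.lookup ρ i
      ⟦ e ⊗ f ⟧ = ⟦ e ⟧ ∙ ⟦ f ⟧
      ⟦ inv e ⟧ = ⟦ e ⟧ ⁻¹

      signed : Bool → X → X
      signed true  x = x
      signed false x = x ⁻¹

      ⟦_⟧ₗ : List (Letter n) → X
      ⟦ [] ⟧ₗ = ε
      ⟦ (s , i) ∷ ls ⟧ₗ = signed s (Vec.lookup ρ i) ∙ ⟦ ls ⟧ₗ

      signed-cancel : ∀ s x y → signed s x ∙ (signed (not s) x ∙ y) ≡ y
      signed-cancel true  x y = trans (sym (assoc x (x ⁻¹) y)) (trans (cong (_∙ y) (inverseʳ x)) (identityˡ y))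
      signed-cancel false x y = trans (sym (assoc (x ⁻¹) x y)) (trans (cong (_∙ y) (inverseˡ x)) (identityˡ y))

      push-sound : ∀ s i ls → ⟦ push (s , i) ls ⟧ₗ ≡ signed s (Vec.lookup ρ i) ∙ ⟦ ls ⟧ₗ
      push-sound s i [] = refl
      push-sound s i ((t , j) ∷ ls) with ≡-dec Boolₚ._≟_ Finₚ._≟_ (not s , i) (t , j)
      ... | yes refl = sym (signed-cancel s (Vec.lookup ρ i) ⟦ ls ⟧ₗ)
      ... | no _     = refl

      signed-inv : ∀ s x → signed (not s) x ≡ signed s (x ⁻¹)
      signed-inv true  x = refl
      signed-inv false x = sym (⁻¹-involutive x)

      flatten-sound : ∀ s e k → ⟦ flatten s e k ⟧ₗ ≡ signed s ⟦ e ⟧ ∙ ⟦ k ⟧ₗ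
      flatten-sound s (var i) k = push-sound s i k
      flatten-sound true (e ⊗ f) k = trans (flatten-sound true e _)
        (trans (cong (⟦ e ⟧ ∙_) (flatten-sound true f k)) (sym (assoc _ _ _)))
      flatten-sound false (e ⊗ f) k = trans (flatten-sound false f _)
        (trans (cong ((⟦ f ⟧ ⁻¹) ∙_) (flatten-sound false e k))
        (trans (sym (assoc _ _ _)) (cong (_∙ ⟦ k ⟧ₗ) (sym (⁻¹-anti-homo-∙ ⟦ e ⟧ ⟦ f ⟧)))))
      flatten-sound s (inv e) k = trans (flatten-sound (not s) e k) (cong (_∙ ⟦ k ⟧ₗ) (signed-inv s ⟦ e ⟧))

      by-reduction : ∀ e f → flatten true e [] ≡ flatten true f [] → ⟦ e ⟧ ≡ ⟦ f ⟧
      by-reduction e f eq = begin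
        ⟦ e ⟧                      ≡⟨ sym (identityʳ _) ⟩
        ⟦ e ⟧ ∙ ε                  ≡⟨ sym (flatten-sound true e []) ⟩
        ⟦ flatten true e [] ⟧ₗ     ≡⟨ cong ⟦_⟧ₗ eq ⟩
        ⟦ flatten true f [] ⟧ₗ     ≡⟨ flatten-sound true f [] ⟩
        ⟦ f ⟧ ∙ ε                  ≡⟨ identityʳ _ ⟩
        ⟦ f ⟧                      ∎
        where open ≡-Reasoning

  from-quot : ∀ {v a b a′} → b ∙ (a′ ⁻¹) ≡ v ∙ (a ⁻¹) → v ≡ (b ∙ (a′ ⁻¹)) ∙ a
  from-quot {v} {a} eq = trans
    (by-reduction (v ∷ a ∷ []) (var 0F) ((var 0F ⊗ inv (var 1F)) ⊗ var 1F) refl)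
    (cong (_∙ a) (sym eq))

  -- Words of bounded length

  alphabet : List X → List X
  alphabet S = ε ∷ S ++ map _⁻¹ S

  alphabet-⁻¹ : ∀ {S x} → x ∈ alphabet S → (x ⁻¹) ∈ alphabet S
  alphabet-⁻¹ {S} (here refl) = here ε⁻¹≈ε
  alphabet-⁻¹ {S} (there x∈) with ∈-++⁻ S x∈
  ... | inj₁ x∈S = there (∈-++⁺ʳ S (∈-map⁺ _⁻¹ x∈S))
  ... | inj₂ x∈S⁻¹ with ∈-map⁻ _⁻¹ x∈S⁻¹
  ... | y , y∈ , refl = there (∈-++⁺ˡ (subst (_∈ S) (sym (⁻¹-involutive y)) y∈))

  abstract

    -- The letter `ε` makes words of length `r` include all shorter ones, so lengths may be relaxed
    -- freely. Repetitions are kept, which makes the count an exact power.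
    words : List X → ℕ → List X
    words S zero    = ε ∷ []
    words S (suc r) = cartesianProductWith _∙_ (alphabet S) (words S r)

    length-words : ∀ S r → length (words S r) ≡ (1 + (length S + length S)) ^ r
    length-words S zero    = refl
    length-words S (suc r) = trans (length-cartesianProductWith _∙_ (alphabet S) (words S r))
      (cong₂ _*_ (cong suc (trans (length-++ S) (cong (length S +_) (length-map _⁻¹ S)))) (length-words S r))

    letter : ∀ {S x} → x ∈ alphabet S → x ∈ words S 1
    letter {S} {x} x∈ = subst (_∈ words S 1) (identityʳ x) (∈-cartesianProductWith⁺ _∙_ x∈ (here refl))

    gen : ∀ {S x} → x ∈ S → x ∈ words S 1
    gen {S} x∈ = letter {S} (there (∈-++⁺ˡ x∈))

    ε∈words : ∀ S r → ε ∈ words S r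
    ε∈words S zero    = here refl
    ε∈words S (suc r) = subst (_∈ words S (suc r)) (identityˡ ε)
      (∈-cartesianProductWith⁺ _∙_ {xs = alphabet S} {ys = words S r} (here refl) (ε∈words S r))

    words-∙ : ∀ {S} i {j x y} → x ∈ words S i → y ∈ words S j → (x ∙ y) ∈ words S (i + j)
    words-∙ zero (here refl) y∈ = subst (_∈ _) (sym (identityˡ _)) y∈
    words-∙ {S} (suc i) {j} {y = y} x∈ y∈ with ∈-cartesianProductWith⁻ _∙_ (alphabet S) (words S i) x∈
    ... | l , w , l∈ , w∈ , refl = subst (_∈ words S (suc (i + j))) (sym (assoc l w y))
      (∈-cartesianProductWith⁺ _∙_ l∈ (words-∙ i w∈ y∈))

    words-≤ : ∀ {S i j x} → i ≤ j → x ∈ words S i → x ∈ words S j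
    words-≤ {S} {i} {j} {x} i≤j x∈ = subst₂ (λ x j → x ∈ words S j) (identityʳ x) (m+[n∸m]≡n i≤j)
      (words-∙ i x∈ (ε∈words S (j ∸ i)))

    words-⁻¹ : ∀ {S} r {x} → x ∈ words S r → (x ⁻¹) ∈ words S r
    words-⁻¹ zero (here refl) = here ε⁻¹≈ε
    words-⁻¹ {S} (suc r) x∈ with ∈-cartesianProductWith⁻ _∙_ (alphabet S) (words S r) x∈
    ... | l , w , l∈ , w∈ , refl = subst₂ (λ x j → x ∈ words S j) (sym (⁻¹-anti-homo-∙ l w)) (+-comm r 1)
      (words-∙ r (words-⁻¹ r w∈) (letter {S} (alphabet-⁻¹ {S} l∈)))

    words-⊆ : ∀ {S S′} → (∀ {x} → x ∈ S → x ∈ S′) → ∀ r {x} → x ∈ words S r → x ∈ words S′ r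
    words-⊆ S⊆ zero x∈ = x∈
    words-⊆ {S} {S′} S⊆ (suc r) x∈ with ∈-cartesianProductWith⁻ _∙_ (alphabet S) (words S r) x∈
    ... | l , w , l∈ , w∈ , refl = ∈-cartesianProductWith⁺ _∙_ (sub l∈) (words-⊆ S⊆ r w∈)
      where
      sub : ∀ {l} → l ∈ alphabet S → l ∈ alphabet S′
      sub (here refl) = here refl
      sub (there l∈) with ∈-++⁻ S l∈
      ... | inj₁ l∈S = there (∈-++⁺ˡ (S⊆ l∈S))
      ... | inj₂ l∈S⁻¹ with ∈-map⁻ _⁻¹ l∈S⁻¹
      ... | y , y∈ , refl = there (∈-++⁺ʳ S′ (∈-map⁺ _⁻¹ (S⊆ y∈)))

  -- Spelling a set by short words in few generators

  module Encoding
   (InH : X → Set) (InH? : Decidable InH) (H-comm : ∀ {x y} → InH x → InH y → x ∙ y ≡ y ∙ x)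
   (Tr : List X) (transversal : ∀ v → ∃ λ x → x ∈ Tr × InH (v ∙ (x ⁻¹)))
   (A : List X) (A! : Unique A) (q : ℕ) (1≤q : 1 ≤ q) (|A| : length A ≡ 4 * q)
   (Qt : List X) (Qt! : Unique Qt) (A/A⊆ : ∀ {a b} → a ∈ A → b ∈ A → (a ∙ (b ⁻¹)) ∈ Qt)
   (s : ℕ) (A<2^s : length A < 2 ^ s)
   where

   m = length Tr
   k = 2 * m * s
   T = length Qt

   quot-inj : ∀ v {a b} → v ∙ (a ⁻¹) ≡ v ∙ (b ⁻¹) → a ≡ b
   quot-inj v eq = ⁻¹-injective (∙-cancelˡ v _ _ eq)

   open Greedy _≟_ (λ v a → v ∙ (a ⁻¹)) quot-inj A A! Qt Qt! A A/A⊆ q 1≤q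

   module _ (B : List X) (few-new : ∀ {v} → v ∈ A → new B v < q) where

    S₀ : List X
    S₀ = B ++ Tr

    -- Separation in the left-invariant word metric of `S₀`. The map `v ↦ a v⁻¹ b` inverts `v` and
    -- so asks for right-invariant separation; this is what forces each step to work inside a single
    -- coset of `H`.
    Sep : ℕ → X → X → Set
    Sep r v v′ = (v ⁻¹) ∙ v′ ∉ words S₀ r

    -- Two elements of one coset Hx: commutativity of H turns left into right separation.
    sep-right : ∀ {r x v v′} → x ∈ Tr → InH (v ∙ (x ⁻¹)) → InH (v′ ∙ (x ⁻¹)) →
                Sep (2 + r) v v′ → (v ∙ (v′ ⁻¹)) ∉ words S₀ r
    sep-right {r} {x} {v} {v′} x∈ h h′ sep w∈ = sep (subst (_∈ words S₀ (2 + r)) (sym eq)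
        (words-∙ 1 (words-⁻¹ 1 x∈W) (subst (λ l → (((v ∙ (v′ ⁻¹)) ⁻¹) ∙ x) ∈ words S₀ l) (+-comm r 1) (words-∙ r (words-⁻¹ r w∈) x∈W))))
      where
      x∈W : x ∈ words S₀ 1
      x∈W = gen (∈-++⁺ʳ B x∈)
      open ≡-Reasoning
      y = v ∙ (x ⁻¹)
      y′ = v′ ∙ (x ⁻¹)
      eq : (v ⁻¹) ∙ v′ ≡ (x ⁻¹) ∙ (((v ∙ (v′ ⁻¹)) ⁻¹) ∙ x)
      eq = begin
        (v ⁻¹) ∙ v′
          ≡⟨ by-reduction (v ∷ v′ ∷ x ∷ []) (inv (var 0F) ⊗ var 1F)
               (inv (var 2F) ⊗ ((inv (var 0F ⊗ inv (var 2F)) ⊗ ((var 1F ⊗ inv (var 2F)) ⊗ (var 0F ⊗ inv (var 2F)))) ⊗ inv (var 0F ⊗ inv (var 2F))) ⊗ var 2F) refl ⟩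
        ((x ⁻¹) ∙ (((y ⁻¹) ∙ (y′ ∙ y)) ∙ (y ⁻¹))) ∙ x
          ≡⟨ cong (λ z → ((x ⁻¹) ∙ (((y ⁻¹) ∙ z) ∙ (y ⁻¹))) ∙ x) (H-comm h′ h) ⟩
        ((x ⁻¹) ∙ (((y ⁻¹) ∙ (y ∙ y′)) ∙ (y ⁻¹))) ∙ x
          ≡⟨ by-reduction (v ∷ v′ ∷ x ∷ [])
               (inv (var 2F) ⊗ ((inv (var 0F ⊗ inv (var 2F)) ⊗ ((var 0F ⊗ inv (var 2F)) ⊗ (var 1F ⊗ inv (var 2F)))) ⊗ inv (var 0F ⊗ inv (var 2F))) ⊗ var 2F)
               (inv (var 2F) ⊗ (inv (var 0F ⊗ inv (var 1F)) ⊗ var 2F)) refl ⟩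
        (x ⁻¹) ∙ (((v ∙ (v′ ⁻¹)) ⁻¹) ∙ x) ∎

    NewVertex : X → X → X → Set
    NewVertex a v y = ∃ λ b → b ∈ B × y ∈ A × y ≡ (a ∙ (v ⁻¹)) ∙ b

    new-vertex : ∀ {a v} → Covered B (v ∙ (a ⁻¹)) → ∃ (NewVertex a v)
    new-vertex {a} {v} cov =
      let b , b∈ , cov′ = find cov
          a′ , a′∈ , eq = find cov′
          a′≡ = trans (by-reduction (b ∷ a′ ∷ []) (var 1F) (inv (var 0F ⊗ inv (var 1F)) ⊗ var 0F) refl)
                (trans (cong (λ z → (z ⁻¹) ∙ b) eq)
                (by-reduction (v ∷ a ∷ b ∷ []) (inv (var 0F ⊗ inv (var 1F)) ⊗ var 2F) ((var 1F ⊗ inv (var 0F)) ⊗ var 2F) refl))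
      in a′ , b , b∈ , a′∈ , a′≡

    -- The element `a` cancels: `y⁻¹ y′ = b⁻¹ (v v′⁻¹) b′`. Undoing `b` and `b′` costs two letters.
    sep-new : ∀ {r a v v′ y y′} → (v ∙ (v′ ⁻¹)) ∉ words S₀ (2 + r) →
              NewVertex a v y → NewVertex a v′ y′ → Sep r y y′
    sep-new {r} {a} {v} {v′} out (b , b∈ , _ , refl) (b′ , b′∈ , _ , refl) w∈ =
      out (subst₂ (λ z l → z ∈ words S₀ l)
        (by-reduction (a ∷ v ∷ v′ ∷ b ∷ b′ ∷ [])
          (var 3F ⊗ ((inv ((var 0F ⊗ inv (var 1F)) ⊗ var 3F) ⊗ ((var 0F ⊗ inv (var 2F)) ⊗ var 4F)) ⊗ inv (var 4F)))
          (var 1F ⊗ inv (var 2F)) refl)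
        (cong suc (+-comm r 1))
        (words-∙ 1 (gen (∈-++⁺ˡ b∈)) (words-∙ r w∈ (words-⁻¹ 1 (gen (∈-++⁺ˡ b′∈))))))

    known? : ∀ S → Decidable (_∈ words S (4 * k))
    known? S x = x ∈? words S (4 * k)

    HalfKnown : List X → Set
    HalfKnown S = 2 * q ≤ cnt (known? S) A

    -- Otherwise each of at least `2 q + 1` unspelled `a` would be bad for at least `c` of the `v`,
    -- where `length V ≤ 2 c`, whereas `few-new` allows each `v` fewer than `q` bad `a`. Then
    -- `(2 q + 1) c ≤ q length V ≤ 2 q c`, which is impossible.
    good-element : ∀ S V → 1 ≤ length V → (∀ {v} → v ∈ V → v ∈ A) → ¬ HalfKnown S →
                   ∃ λ a → a ∈ A × a ∉ words S (4 * k) ×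
                           length V ≤ 2 * cnt (λ v → covered? B (v ∙ (a ⁻¹))) V
    good-element S V 1≤V V⊆A ¬half
      with any? (λ a → length V ≤? 2 * cnt (λ v → covered? B (v ∙ (a ⁻¹))) V) (filter (¬? ∘ known? S) A)
    ... | yes p = let a , a∈ , h = find p
                      a∈A , a∉ = ∈-filter⁻ (¬? ∘ known? S) {xs = A} a∈
                  in a , a∈A , a∉ , h
    ... | no none = contradiction (begin
        c + 2 * q * c        ≤⟨ *-monoˡ-≤ c many ⟩
        length Au * c        ≤⟨ double-count (λ a v → ¬? (covered? B (v ∙ (a ⁻¹)))) Au V lo hi ⟩
        length V * q         ≤⟨ *-monoˡ-≤ q V≤2c ⟩
        (c + c) * q          ≡⟨ solve 2 (λ c q → (c :+ c) :* q := con 2 :* q :* c) refl c q ⟩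
        2 * q * c            ∎) (<⇒≱ (m<n+m (2 * q * c) (s≤s z≤n)))
      where
      open ≤-Reasoning
      Au = filter (¬? ∘ known? S) A
      f = ⌊ length V /2⌋
      c = suc f
      good : X → ℕ
      good a = cnt (λ v → covered? B (v ∙ (a ⁻¹))) V
      bad : X → ℕ
      bad a = cnt (λ v → ¬? (covered? B (v ∙ (a ⁻¹)))) V
      V≤2c : length V ≤ c + c
      V≤2c = begin
        length V                       ≡⟨ sym (⌊n/2⌋+⌈n/2⌉≡n (length V)) ⟩
        f + ⌈ length V /2⌉             ≤⟨ +-mono-≤ (n≤1+n f) (⌊n/2⌋-mono (n≤1+n (suc (length V)))) ⟩
        c + c                          ∎
      many : suc (2 * q) ≤ length Au
      many = +-cancelˡ-< (2 * q) _ _ (begin-strict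
        2 * q + 2 * q                  ≡⟨ solve 1 (λ q → con 2 :* q :+ con 2 :* q := con 4 :* q) refl q ⟩
        4 * q                          ≡⟨ sym |A| ⟩
        length A                       ≡⟨ sym (cnt-∁ (known? S) A) ⟩
        cnt (known? S) A + length Au   <⟨ +-monoˡ-< (length Au) (≰⇒> ¬half) ⟩
        2 * q + length Au              ∎)
      lo : ∀ {a} → a ∈ Au → c ≤ bad a
      lo {a} a∈ = +-cancelʳ-< _ _ _ (begin-strict
        f + good a                     <⟨ +-monoʳ-< f (≰⇒> λ ceil≤ → none (lose a∈ (begin
             length V                    ≡⟨ sym (⌊n/2⌋+⌈n/2⌉≡n (length V)) ⟩
             f + ⌈ length V /2⌉          ≤⟨ +-monoˡ-≤ _ (⌊n/2⌋≤⌈n/2⌉ (length V)) ⟩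
             ⌈ length V /2⌉ + ⌈ length V /2⌉ ≤⟨ +-mono-≤ ceil≤ ceil≤ ⟩
             good a + good a             ≡⟨ cong (good a +_) (sym (+-identityʳ (good a))) ⟩
             2 * good a                  ∎))) ⟩
        f + ⌈ length V /2⌉             ≡⟨ ⌊n/2⌋+⌈n/2⌉≡n (length V) ⟩
        length V                       ≡⟨ sym (cnt-∁ (λ v → covered? B (v ∙ (a ⁻¹))) V) ⟩
        good a + bad a                 ≡⟨ +-comm (good a) (bad a) ⟩
        bad a + good a                 ∎)
      hi : ∀ {v} → v ∈ V → cnt (λ a → ¬? (covered? B (v ∙ (a ⁻¹)))) Au ≤ q
      hi {v} v∈ = ≤-trans (⊆⇒length≤ (Unq.filter⁺ _ (Unq.filter⁺ _ A!))
          λ x∈ → let x∈Au , nc = ∈-filter⁻ (λ a → ¬? (covered? B (v ∙ (a ⁻¹)))) {xs = Au} x∈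
                 in ∈-filter⁺ _ (proj₁ (∈-filter⁻ (¬? ∘ known? S) {xs = A} x∈Au)) nc)
        (<⇒≤ (few-new (V⊆A v∈)))

    -- V is a family of vertices spelled by short words in S which stay distinct modulo the
    -- generators S₀; i counts the remaining steps, j the ones already made.
    record Stage (i j : ℕ) : Set where
      field
        S     : List X
        V     : List X
        i+j   : i + j ≡ k
        S₀⊆S  : ∀ {x} → x ∈ S₀ → x ∈ S
        |S|   : length S ≤ suc (length S₀) + j
        V⊆A   : ∀ {v} → v ∈ V → v ∈ A
        V⊆W   : ∀ {v} → v ∈ V → v ∈ words S (1 + 2 * j)
        -- Each step uses up four letters of separation: two for conjugating by a coset
        -- representative, two for the elements of `B`.
        apart : AllPairs (Sep (i * 4)) V
        large : (1 + 2 * m) ^ j ≤ length V * (2 * m) ^ j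

    ∃HalfKnown : Set
    ∃HalfKnown = ∃ λ S → length S ≤ suc (length S₀) + k × (∀ {x} → x ∈ S₀ → x ∈ S) × HalfKnown S

    1≤m : 1 ≤ m
    1≤m = ∈-length (proj₁ (proj₂ (transversal ε)))

    module Step {i j : ℕ} (st : Stage (suc i) j)
      {a : X} (a∉ : a ∉ words (Stage.S st) (4 * k)) {V′ Y : List X}
      (V≤2mV′ : length (Stage.V st) ≤ 2 * m * length V′)
      (V′⊆V : ∀ {v} → v ∈ V′ → v ∈ Stage.V st)
      (V′-sep : AllPairs (λ v v′ → (v ∙ (v′ ⁻¹)) ∉ words S₀ (2 + i * 4)) V′)
      (ptw : Pointwise (NewVertex a) V′ Y) where

      open Stage st

      case-++ : ∀ (P : X → Set) {zs v} → v ∈ V ++ zs → (v ∈ V → P v) → (v ∈ zs → P v) → P v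
      case-++ P v∈ f g with ∈-++⁻ V v∈
      ... | inj₁ p = f p
      ... | inj₂ p = g p
      Y⊆A : ∀ {y} → y ∈ Y → y ∈ A
      Y⊆A y∈ = let _ , _ , _ , _ , y∈A , _ = pointwise-∈ ptw y∈ in y∈A
      Y⊆W : ∀ {y} → y ∈ Y → y ∈ words (a ∷ S) (1 + 2 * suc j)
      Y⊆W y∈ with pointwise-∈ ptw y∈
      ... | v , v∈ , b , b∈ , _ , refl = subst (λ l → ((a ∙ (v ⁻¹)) ∙ b) ∈ words (a ∷ S) l)
            (solve 1 (λ j → con 1 :+ (con 1 :+ con 2 :* j) :+ con 1 := con 1 :+ con 2 :* (con 1 :+ j)) refl j)
            (words-∙ (1 + (1 + 2 * j)) (words-∙ 1 (gen (here refl))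
               (words-⁻¹ (1 + 2 * j) (words-⊆ there _ (V⊆W (V′⊆V v∈)))))
               (gen (there (S₀⊆S (∈-++⁺ˡ b∈)))))
      -- A new vertex close to an old one would spell `a` itself, as `a = v″ (v″⁻¹ y) b⁻¹ v`. The
      -- lengths add up to `4 i + 4 j + 3 < 4 k`, which is why being known is measured at radius
      -- `4 k`.
      cross : ∀ {v″ y} → v″ ∈ V → y ∈ Y → Sep (i * 4) v″ y
      cross {v″} v″∈ y∈ w∈ with pointwise-∈ ptw y∈
      ... | v , v∈ , b , b∈ , _ , refl = a∉ (words-≤ bound (subst (_∈ words S _) a≡
            (words-∙ (1 + 2 * j) (V⊆W v″∈) (words-∙ (i * 4) (words-⊆ S₀⊆S (i * 4) w∈)
              (words-∙ 1 (words-⁻¹ 1 (gen (S₀⊆S (∈-++⁺ˡ b∈)))) (V⊆W (V′⊆V v∈)))))))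
        where
        a≡ : v″ ∙ (((v″ ⁻¹) ∙ ((a ∙ (v ⁻¹)) ∙ b)) ∙ ((b ⁻¹) ∙ v)) ≡ a
        a≡ = by-reduction (v″ ∷ a ∷ v ∷ b ∷ [])
               (var 0F ⊗ ((inv (var 0F) ⊗ ((var 1F ⊗ inv (var 2F)) ⊗ var 3F)) ⊗ (inv (var 3F) ⊗ var 2F))) (var 1F) refl
        bound : 1 + 2 * j + (i * 4 + (1 + (1 + 2 * j))) ≤ 4 * k
        bound = ≤-trans (n≤1+n _) (≤-reflexive (trans
          (solve 2 (λ i j → con 1 :+ (con 1 :+ con 2 :* j :+ (i :* con 4 :+ (con 1 :+ (con 1 :+ con 2 :* j)))) := con 4 :* (con 1 :+ i :+ j)) refl i j)
          (cong (4 *_) i+j)))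
      Y-large : length V ≤ 2 * m * length Y
      Y-large = ≤-trans V≤2mV′ (≤-reflexive (cong (2 * m *_) (Pointwise-length ptw)))
      large′ : (1 + 2 * m) ^ suc j ≤ length (V ++ Y) * (2 * m) ^ suc j
      large′ = begin
        M⁺ * M⁺ ^ j                         ≤⟨ *-monoʳ-≤ M⁺ large ⟩
        M⁺ * (length V * M ^ j)             ≡⟨ sym (*-assoc M⁺ (length V) _) ⟩
        (length V + M * length V) * M ^ j   ≤⟨ *-monoˡ-≤ (M ^ j) (+-monoˡ-≤ (M * length V) Y-large) ⟩
        (M * length Y + M * length V) * M ^ j ≡⟨ solve 4 (λ M y v e → (M :* y :+ M :* v) :* e := (v :+ y) :* (M :* e)) refl M (length Y) (length V) (M ^ j) ⟩
        (length V + length Y) * (M * M ^ j) ≡⟨ cong (_* (M * M ^ j)) (sym (length-++ V)) ⟩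
        length (V ++ Y) * (M * M ^ j)       ∎
        where
        open ≤-Reasoning
        M = 2 * m
        M⁺ = 1 + 2 * m

      next : Stage i (suc j)
      next = record
        { S = a ∷ S ; V = V ++ Y
        ; i+j = trans (+-suc i j) i+j
        ; S₀⊆S = there ∘ S₀⊆S
        ; |S| = ≤-trans (s≤s |S|) (≤-reflexive (sym (+-suc (suc (length S₀)) j)))
        ; V⊆A = λ v∈ → case-++ (_∈ A) v∈ V⊆A Y⊆A
        ; V⊆W = λ v∈ → case-++ (_∈ words (a ∷ S) (1 + 2 * suc j)) v∈ (λ v∈V → words-⊆ there _ (words-≤ (s≤s (*-monoʳ-≤ 2 (n≤1+n j))) (V⊆W v∈V))) Y⊆W
        ; apart = AllPairsₚ.++⁺ (AllPairs.map (λ sep w∈ → sep (words-≤ (m≤n+m (i * 4) 4) w∈)) apart)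
                    (pointwise-AllPairs sep-new ptw V′-sep)
                    (All.tabulate λ v∈ → All.tabulate λ y∈ → cross v∈ y∈)
        ; large = large′ }

    -- Passing to a popular coset costs a factor `m`, keeping only the `v` that are good for `a` a
    -- factor 2. Each survivor yields one new vertex, so `V` grows at least by the factor
    -- `1 + 1/(2 m)`.
    step : ∀ {i j} (st : Stage (suc i) j) → ¬ HalfKnown (Stage.S st) → Stage i (suc j)
    step {i} {j} st ¬half = at-coset (popular (λ v x → InH? (v ∙ (x ⁻¹))) {V} Tr 1≤V (λ {v} _ → transversal v))
      where
      open Stage st
      1≤V : 1 ≤ length V
      1≤V = positiveˡ (length V) (≤-trans (m^n>0 (1 + 2 * m) j) large)
      at-coset : (∃ λ x → x ∈ Tr × length V ≤ m * cnt (λ v → InH? (v ∙ (x ⁻¹))) V) → Stage i (suc j)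
      at-coset (x , x∈Tr , V≤mV₁) = at-element (good-element S V₁ 1≤V₁ (V⊆A ∘ proj₁ ∘ V₁⊆) ¬half)
        where
        V₁ = filter (λ v → InH? (v ∙ (x ⁻¹))) V
        V₁⊆ : ∀ {v} → v ∈ V₁ → v ∈ V × InH (v ∙ (x ⁻¹))
        V₁⊆ = ∈-filter⁻ (λ v → InH? (v ∙ (x ⁻¹))) {xs = V}
        1≤V₁ : 1 ≤ length V₁
        1≤V₁ = positiveʳ m (≤-trans 1≤V V≤mV₁)
        at-element : (∃ λ a → a ∈ A × a ∉ words S (4 * k) ×
                              length V₁ ≤ 2 * cnt (λ v → covered? B (v ∙ (a ⁻¹))) V₁) → Stage i (suc j)
        at-element (a , _ , a∉ , V₁≤2V′) =
          Step.next st a∉ V≤2mV′ (proj₁ ∘ V₁⊆ ∘ proj₁ ∘ V′⊆) V′-sep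
            (proj₂ (choose {R = NewVertex a} (All.tabulate {xs = V′} (λ v∈ → new-vertex (proj₂ (V′⊆ v∈))))))
          where
          V′ = filter (λ v → covered? B (v ∙ (a ⁻¹))) V₁
          V′⊆ : ∀ {v} → v ∈ V′ → v ∈ V₁ × Covered B (v ∙ (a ⁻¹))
          V′⊆ = ∈-filter⁻ (λ v → covered? B (v ∙ (a ⁻¹))) {xs = V₁}
          V′-sep : AllPairs (λ v v′ → (v ∙ (v′ ⁻¹)) ∉ words S₀ (2 + i * 4)) V′
          V′-sep = AllPairs.map
            (λ (v∈ , v′∈ , sep) → sep-right x∈Tr (proj₂ (V₁⊆ (proj₁ (V′⊆ v∈)))) (proj₂ (V₁⊆ (proj₁ (V′⊆ v′∈)))) sep)
            (AllPairs-∈ (AllPairsₚ.filter⁺ (λ v → covered? B (v ∙ (a ⁻¹))) (AllPairsₚ.filter⁺ (λ v → InH? (v ∙ (x ⁻¹))) apart)))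
          V≤2mV′ : length V ≤ 2 * m * length V′
          V≤2mV′ = begin
            length V            ≤⟨ V≤mV₁ ⟩
            m * length V₁       ≤⟨ *-monoʳ-≤ m V₁≤2V′ ⟩
            m * (2 * length V′) ≡⟨ solve 2 (λ m v → m :* (con 2 :* v) := con 2 :* m :* v) refl m (length V′) ⟩
            2 * m * length V′   ∎
            where
            open ≤-Reasoning

    apart⇒Unique : ∀ {r V} → AllPairs (Sep r) V → Unique V
    apart⇒Unique {r} = AllPairs.map λ { {x} sep refl → sep (subst (_∈ words S₀ r) (sym (inverseˡ x)) (ε∈words S₀ r)) }

    -- For `M = 2 m` one has `(1 + 1/M)^M ≥ 2`, so after `k = M s` steps `V` would have at least
    -- `2^s` members, more than `A` contains. Separation at radius 0 still guarantees that they are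
    -- distinct.
    no-last : Stage 0 k → ⊥
    no-last st = <-irrefl refl (begin-strict
      2 ^ s * M ^ k           ≡⟨ cong (2 ^ s *_) (sym (^-*-assoc M M s)) ⟩
      2 ^ s * (M ^ M) ^ s     ≡⟨ sym (*-^ 2 (M ^ M) s) ⟩
      (2 * M ^ M) ^ s         ≤⟨ ^-monoˡ-≤ s (2*^≤suc^ {M} ≤-refl (*-mono-≤ {1} {2} (s≤s z≤n) 1≤m)) ⟩
      (suc M ^ M) ^ s         ≡⟨ ^-*-assoc (suc M) M s ⟩
      suc M ^ k               ≤⟨ large ⟩
      length V * M ^ k        ≤⟨ *-monoˡ-≤ (M ^ k) (⊆⇒length≤ (apart⇒Unique apart) V⊆A) ⟩
      length A * M ^ k        <⟨ *-monoˡ-< (M ^ k) {{m^n≢0 M k {{M≢0}}}} A<2^s ⟩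
      2 ^ s * M ^ k           ∎)
      where
      open Stage st
      open ≤-Reasoning
      M = 2 * m
      M≢0 : NonZero M
      M≢0 = >-nonZero (*-mono-≤ {1} {2} (s≤s z≤n) 1≤m)

    run : ∀ i {j} → Stage i j → ∃HalfKnown
    run i {j} st with 2 * q ≤? cnt (known? (Stage.S st)) A
    ... | yes half = S , ≤-trans |S| (+-monoʳ-≤ (suc (length S₀)) (≤-trans (m≤n+m j i) (≤-reflexive i+j))) , S₀⊆S , half
      where open Stage st
    run zero st    | no _ with Stage.i+j st
    ... | refl = ⊥-elim (no-last st)
    run (suc i) st | no ¬half = run i (step st ¬half)

    A-element : ∃ (_∈ A)
    A-element = nonempty A (≤-trans (*-mono-≤ {1} {4} (s≤s z≤n) 1≤q) (≤-reflexive (sym |A|)))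

    half-known : ∃HalfKnown
    half-known = run k (record
      { S = a ∷ S₀ ; V = a ∷ [] ; i+j = +-identityʳ k ; S₀⊆S = there
      ; |S| = ≤-reflexive (sym (+-identityʳ _))
      ; V⊆A = λ { (here refl) → proj₂ A-element }
      ; V⊆W = λ { (here refl) → gen (here refl) }
      ; apart = [] ∷ [] ; large = ≤-refl })
      where a = proj₁ A-element

   -- Ruzsa's covering argument passes from the known half to all of A.
   encode : ∃ λ S → ∃₂ λ b c → b * q ≤ T × c * q ≤ T × length S ≤ b + m + k + 1 + c ×
            (∀ {v} → v ∈ A → v ∈ words S (1 + 8 * k))
   encode = C ++ S , length B , length C , proj₁ (proj₂ (proj₂ greedy)) ,
       ≤-trans (*-monoʳ-≤ (length C) (≤-trans (m≤n*m q 2) half)) (proj₁ (proj₂ (proj₂ G.greedy))) ,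
       len , A⊆W
     where
     B = proj₁ greedy
     few = λ {v} → proj₂ (proj₂ (proj₂ greedy)) {v}
     halfK = half-known B few
     S = proj₁ halfK
     half : 2 * q ≤ cnt (known? B few S) A
     half = proj₂ (proj₂ (proj₂ halfK))
     A′ = filter (known? B few S) A
     A′⊆ : ∀ {a} → a ∈ A′ → a ∈ A × a ∈ words S (4 * k)
     A′⊆ = ∈-filter⁻ (known? B few S) {xs = A}
     1≤A′ : 1 ≤ length A′
     1≤A′ = ≤-trans (*-mono-≤ {1} {2} (s≤s z≤n) 1≤q) half
     -- The threshold is all of `A′`, so in the end no translate `v A′⁻¹` is disjoint from `C A′⁻¹`;
     -- hence `v = c a′⁻¹ a`, with `a` and `a′` each spelled in `4 k` letters.
     module G = Greedy _≟_ (λ v a → v ∙ (a ⁻¹)) quot-inj A′ (Unq.filter⁺ _ A!) Qt Qt! A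
                       (λ v∈ a∈ → A/A⊆ v∈ (proj₁ (A′⊆ a∈))) (length A′) 1≤A′
     C = proj₁ G.greedy
     len : length (C ++ S) ≤ length B + m + k + 1 + length C
     len = begin
       length (C ++ S)                          ≡⟨ length-++ C ⟩
       length C + length S                      ≤⟨ +-monoʳ-≤ (length C) (proj₁ (proj₂ halfK)) ⟩
       length C + (suc (length (B ++ Tr)) + k)  ≡⟨ cong (λ z → length C + (suc z + k)) (length-++ B) ⟩
       length C + (suc (length B + m) + k)      ≡⟨ solve 4 (λ c b m k → c :+ (con 1 :+ (b :+ m) :+ k) := b :+ m :+ k :+ con 1 :+ c) refl (length C) (length B) m k ⟩
       length B + m + k + 1 + length C          ∎
       where
       open ≤-Reasoning
     A⊆W : ∀ {v} → v ∈ A → v ∈ words (C ++ S) (1 + 8 * k)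
     A⊆W {v} v∈ =
       let pos = +-cancelʳ-≤ (G.new C v) 1 _ (≤-trans (proj₂ (proj₂ (proj₂ G.greedy)) v∈)
                   (≤-reflexive (sym (cnt-∁ (λ a → G.covered? C (v ∙ (a ⁻¹))) A′))))
           a , a∈ , cov = cnt-witness (λ a → G.covered? C (v ∙ (a ⁻¹))) A′ pos
           c , c∈ , cov′ = find cov
           a′ , a′∈ , eq = find cov′
           lift = λ {x} → words-⊆ {S} {C ++ S} (∈-++⁺ʳ C) (4 * k) {x}
       in subst₂ (λ z l → z ∈ words (C ++ S) l) (sym (from-quot eq))
            (cong suc (solve 1 (λ k → con 4 :* k :+ con 4 :* k := con 8 :* k) refl k))
            (words-∙ (1 + 4 * k) (words-∙ 1 (gen (∈-++⁺ˡ c∈)) (words-⁻¹ (4 * k) (lift (proj₂ (A′⊆ a′∈)))))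
                                 (lift (proj₂ (A′⊆ a∈))))

-- Subsets as lists

elements : ∀ {n} → Subset n → List (Fin n)
elements []            = []
elements (inside  ∷ p) = zero ∷ map suc (elements p)
elements (outside ∷ p) = map suc (elements p)

elements⁺ : ∀ {n} {p : Subset n} {x} → x ∈ₛ p → x ∈ elements p
elements⁺ {p = inside  ∷ p} Vec.here        = here refl
elements⁺ {p = inside  ∷ p} (Vec.there x∈)  = there (∈-map⁺ suc (elements⁺ x∈))
elements⁺ {p = outside ∷ p} (Vec.there x∈)  = ∈-map⁺ suc (elements⁺ x∈)

elements⁻ : ∀ {n} (p : Subset n) {x} → x ∈ elements p → x ∈ₛ p
elements⁻ (inside ∷ p) (here refl) = Vec.here
elements⁻ (inside ∷ p) (there x∈) with ∈-map⁻ suc x∈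
... | y , y∈ , refl = Vec.there (elements⁻ p y∈)
elements⁻ (outside ∷ p) x∈ with ∈-map⁻ suc x∈
... | y , y∈ , refl = Vec.there (elements⁻ p y∈)

elements! : ∀ {n} (p : Subset n) → Unique (elements p)
elements! []            = []
elements! (inside  ∷ p) = All.tabulate (λ x∈ → λ { refl → 0∉ x∈ }) ∷ Unq.map⁺ Finₚ.suc-injective (elements! p)
  where
  0∉ : zero ∉ map suc (elements p)
  0∉ x∈ with ∈-map⁻ suc x∈
  ... | _ , _ , ()
elements! (outside ∷ p) = Unq.map⁺ Finₚ.suc-injective (elements! p)

length-elements : ∀ {n} (p : Subset n) → length (elements p) ≡ ∣ p ∣
length-elements []            = refl
length-elements (inside  ∷ p) = cong suc (trans (length-map suc (elements p)) (length-elements p))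
length-elements (outside ∷ p) = trans (length-map suc (elements p)) (length-elements p)

-- Subgroups of order 2 and 3, and the paired colouring

module Colouring {N : ℕ} (G : FiniteGroup N) (H : Subset N)
                 (isAbelian : IsAbelianSubgroup G H) (coprime : Coprime ∣ H ∣ 6) where

  open FiniteGroup G
  open IsGroup isGroup using (assoc; identityˡ; identityʳ; inverseˡ; inverseʳ)
  open GroupTheory _≟_ isGroup using (var; _⊗_; inv; by-reduction)

  Gp : Group _ _
  Gp = record { isGroup = isGroup }

  open Groupₚ Gp using (∙-cancelʳ; ⁻¹-anti-homo-∙; ⁻¹-involutive; ε⁻¹≈ε; inverseʳ-unique)

  εH : ε ∈ₛ H
  εH = proj₁ (proj₁ isAbelian)

  ∙H : ∀ {x y} → x ∈ₛ H → y ∈ₛ H → (x ∙ y) ∈ₛ H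
  ∙H = proj₁ (proj₂ (proj₁ isAbelian)) _ _

  ⁻¹H : ∀ {x} → x ∈ₛ H → (x ⁻¹) ∈ₛ H
  ⁻¹H = proj₂ (proj₂ (proj₁ isAbelian)) _

  commH : ∀ {x y} → x ∈ₛ H → y ∈ₛ H → x ∙ y ≡ y ∙ x
  commH = proj₂ isAbelian _ _

  Hs : List (Fin N)
  Hs = elements H

  -- With a full row as threshold the greedy search picks pairwise disjoint cosets and stops when
  -- they cover `H`; the two inequalities for `length B * length is` then meet.
  lagrange : ∀ is → Unique is → 1 ≤ length is →
             (∀ {h h′} → h ∈ is → h′ ∈ is → ((h ⁻¹) ∙ h′) ∈ is) → (∀ {h} → h ∈ is → h ∈ₛ H) →
             length is ∣ ∣ H ∣
  lagrange is is! 1≤ closed is⊆ = subst (length is ∣_) (length-elements H) (divides (length B)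
      (≤-antisym (≤-trans (⊆⇒length≤ (elements! H) cover)
                          (≤-reflexive (length-cartesianProductWith (λ b h → h ∙ b) B is)))
                 (proj₁ (proj₂ (proj₂ greedy)))))
    where
    open Greedy _≟_ (λ v h → h ∙ v) (λ v eq → ∙-cancelʳ v _ _ eq) is is! Hs (elements! H) Hs
                (λ v∈ h∈ → elements⁺ (∙H (is⊆ h∈) (elements⁻ H v∈))) (length is) 1≤
    B = proj₁ greedy
    cover : ∀ {v} → v ∈ Hs → v ∈ cartesianProductWith (λ b h → h ∙ b) B is
    cover {v} v∈ =
      let pos = +-cancelʳ-≤ (new B v) 1 _ (≤-trans (proj₂ (proj₂ (proj₂ greedy)) v∈)
                    (≤-reflexive (sym (cnt-∁ (λ h → covered? B (h ∙ v)) is))))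
          h , h∈ , cov = cnt-witness (λ h → covered? B (h ∙ v)) is pos
          b , b∈ , cov′ = find cov
          h′ , h′∈ , eq = find cov′
      in subst (_∈ cartesianProductWith (λ b h → h ∙ b) B is)
           (trans (assoc _ _ _) (trans (cong ((h ⁻¹) ∙_) eq)
             (by-reduction (h ∷ v ∷ []) (inv (var 0F) ⊗ (var 0F ⊗ var 1F)) (var 1F) refl)))
           (∈-cartesianProductWith⁺ (λ b h → h ∙ b) b∈ (closed h∈ h′∈))

  no-order-2 : ∀ {u} → u ∈ₛ H → u ∙ u ≡ ε → u ≡ ε
  no-order-2 {u} u∈ uu with u ≟ ε
  ... | yes eq = eq
  ... | no u≢ε = contradiction (coprime (lagrange (ε ∷ u ∷ [])
          (((λ e → u≢ε (sym e)) ∷ []) ∷ ([] ∷ [])) (s≤s z≤n) closed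
          (λ { (here refl) → εH ; (there (here refl)) → u∈ }) , divides-refl 3)) λ ()
    where
    u⁻¹ : u ⁻¹ ≡ u
    u⁻¹ = sym (inverseʳ-unique u u uu)
    closed : ∀ {h h′} → h ∈ ε ∷ u ∷ [] → h′ ∈ ε ∷ u ∷ [] → ((h ⁻¹) ∙ h′) ∈ ε ∷ u ∷ []
    closed (here refl) (here refl) = here (inverseˡ ε)
    closed (here refl) (there (here refl)) = there (here (trans (cong (_∙ u) ε⁻¹≈ε) (identityˡ u)))
    closed (there (here refl)) (here refl) = there (here (trans (identityʳ _) u⁻¹))
    closed (there (here refl)) (there (here refl)) = here (inverseˡ u)

  no-order-3 : ∀ {u} → u ∈ₛ H → (u ∙ u) ∙ u ≡ ε → u ≡ ε
  no-order-3 {u} u∈ uuu with u ≟ ε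
  ... | yes eq = eq
  ... | no u≢ε = contradiction (coprime (lagrange is
          (((λ e → u≢ε (sym e)) ∷ (λ e → u≢ε (trans (sym (identityˡ u)) (trans (cong (_∙ u) e) uuu))) ∷ [])
            ∷ ((λ e → u≢ε (sym (∙-cancelʳ u ε u (trans (identityˡ u) e)))) ∷ []) ∷ ([] ∷ []))
          (s≤s z≤n) closed
          (λ { (here refl) → εH ; (there (here refl)) → u∈ ; (there (there (here refl))) → ∙H u∈ u∈ }) ,
          divides-refl 2)) λ ()
    where
    is = ε ∷ u ∷ u ∙ u ∷ []
    u²⁻¹ : (u ∙ u) ⁻¹ ≡ u
    u²⁻¹ = sym (inverseʳ-unique (u ∙ u) u uuu)
    u⁻¹ : u ⁻¹ ≡ u ∙ u
    u⁻¹ = trans (cong _⁻¹ (sym u²⁻¹)) (⁻¹-involutive (u ∙ u))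
    closed : ∀ {h h′} → h ∈ is → h′ ∈ is → ((h ⁻¹) ∙ h′) ∈ is
    closed (here refl) h′∈ = subst (_∈ is) (sym (trans (cong (_∙ _) ε⁻¹≈ε) (identityˡ _))) h′∈
    closed (there (here refl)) (here refl) = there (there (here (trans (identityʳ _) u⁻¹)))
    closed (there (here refl)) (there (here refl)) = here (inverseˡ u)
    closed (there (here refl)) (there (there (here refl))) = there (here (by-reduction (u ∷ []) (inv (var 0F) ⊗ (var 0F ⊗ var 0F)) (var 0F) refl))
    closed (there (there (here refl))) (here refl) = there (here (trans (identityʳ _) u²⁻¹))
    closed (there (there (here refl))) (there (here refl)) = there (there (here (cong (_∙ u) u²⁻¹)))
    closed (there (there (here refl))) (there (there (here refl))) = here (inverseˡ (u ∙ u))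

  -- The colouring: a maximal family M of disjoint pairs {±y, ±2y} in H (additively written), each
  -- coloured non-constantly by one bit; every other pair {z, z⁻¹} gets its own bit.

  infix 4 _~_

  _~_ : Fin N → Fin N → Set
  u ~ v = u ≡ v ⊎ u ≡ v ⁻¹

  _~?_ : ∀ u v → Dec (u ~ v)
  u ~? v = (u ≟ v) ⊎-dec (u ≟ (v ⁻¹))

  ~-sym : ∀ {u v} → u ~ v → v ~ u
  ~-sym (inj₁ e) = inj₁ (sym e)
  ~-sym {u} {v} (inj₂ e) = inj₂ (trans (sym (⁻¹-involutive v)) (cong _⁻¹ (sym e)))

  ~-trans : ∀ {u v w} → u ~ v → v ~ w → u ~ w
  ~-trans (inj₁ refl) q = q
  ~-trans (inj₂ refl) (inj₁ refl) = inj₂ refl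
  ~-trans {w = w} (inj₂ refl) (inj₂ refl) = inj₁ (⁻¹-involutive w)

  ⁻¹-~ : ∀ {u} → (u ⁻¹) ~ u
  ⁻¹-~ = inj₂ refl

  ~-² : ∀ {u v} → u ~ v → (u ∙ u) ~ (v ∙ v)
  ~-² (inj₁ refl) = inj₁ refl
  ~-² {v = v} (inj₂ refl) = inj₂ (sym (⁻¹-anti-homo-∙ v v))

  ²-injective : ∀ {u v} → u ∈ₛ H → v ∈ₛ H → u ∙ u ≡ v ∙ v → u ≡ v
  ²-injective {u} {v} u∈ v∈ eq = trans
      (by-reduction (u ∷ v ∷ []) (var 0F) ((var 0F ⊗ inv (var 1F)) ⊗ var 1F) refl)
      (trans (cong (_∙ v) (no-order-2 (∙H u∈ (⁻¹H v∈)) sq)) (identityˡ v))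
    where
    open ≡-Reasoning
    sq : (u ∙ (v ⁻¹)) ∙ (u ∙ (v ⁻¹)) ≡ ε
    sq = begin
      (u ∙ (v ⁻¹)) ∙ (u ∙ (v ⁻¹))   ≡⟨ cong ((u ∙ (v ⁻¹)) ∙_) (commH u∈ (⁻¹H v∈)) ⟩
      (u ∙ (v ⁻¹)) ∙ ((v ⁻¹) ∙ u)   ≡⟨ by-reduction (u ∷ v ∷ []) ((var 0F ⊗ inv (var 1F)) ⊗ (inv (var 1F) ⊗ var 0F))
                                         ((var 0F ⊗ inv (var 1F ⊗ var 1F)) ⊗ var 0F) refl ⟩
      (u ∙ ((v ∙ v) ⁻¹)) ∙ u        ≡⟨ cong (λ z → (u ∙ (z ⁻¹)) ∙ u) (sym eq) ⟩
      (u ∙ ((u ∙ u) ⁻¹)) ∙ u        ≡⟨ cong (λ z → (z ∙ u)) (by-reduction (u ∷ []) (var 0F ⊗ inv (var 0F ⊗ var 0F)) (inv (var 0F)) refl) ⟩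
      (u ⁻¹) ∙ u                    ≡⟨ inverseˡ u ⟩
      ε                             ∎

  ~-√ : ∀ {u v} → u ∈ₛ H → v ∈ₛ H → (u ∙ u) ~ (v ∙ v) → u ~ v
  ~-√ u∈ v∈ (inj₁ eq) = inj₁ (²-injective u∈ v∈ eq)
  ~-√ {v = v} u∈ v∈ (inj₂ eq) = inj₂ (²-injective u∈ (⁻¹H v∈) (trans eq (⁻¹-anti-homo-∙ v v)))

  -- `y = y⁻²` would produce an element of order 3. If `y` and `y ∙ y` agreed up to inversion, the
  -- opposite colours wanted for them would be incompatible with a symmetric colouring.
  y≁y² : ∀ {y} → y ∈ₛ H → y ≢ ε → ¬ (y ~ y ∙ y)
  y≁y² {y} y∈ y≢ (inj₁ e) = y≢ (∙-cancelʳ y y ε (trans (sym e) (sym (identityˡ y))))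
  y≁y² {y} y∈ y≢ (inj₂ e) = y≢ (no-order-3 y∈ (trans (cong ((y ∙ y) ∙_) e) (inverseʳ (y ∙ y))))

  Near : Fin N → Fin N → Set
  Near y z = z ~ y ⊎ z ~ y ∙ y

  near? : ∀ y z → Dec (Near y z)
  near? y z = (z ~? y) ⊎-dec (z ~? (y ∙ y))

  near-~ : ∀ {y u v} → u ~ v → Near y v → Near y u
  near-~ u~v (inj₁ p) = inj₁ (~-trans u~v p)
  near-~ u~v (inj₂ p) = inj₂ (~-trans u~v p)

  -- The sets `{±x, ±2x}` and `{±y, ±2y}` meet; both are symmetric, so testing `x` and `x ∙ x` is
  -- enough.
  Clash : Fin N → Fin N → Set
  Clash x y = Near y x ⊎ Near y (x ∙ x)

  clash? : ∀ x y → Dec (Clash x y)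
  clash? x y = near? y x ⊎-dec near? y (x ∙ x)

  near⇒clash : ∀ {x y z} → Near x z → Near y z → Clash x y
  near⇒clash (inj₁ z~x)  n = inj₁ (near-~ (~-sym z~x) n)
  near⇒clash (inj₂ z~x²) n = inj₂ (near-~ (~-sym z~x²) n)

  maximal : (xs : List (Fin N)) → ∃ λ M → (∀ {y} → y ∈ M → y ∈ xs) × AllPairs (λ x y → ¬ Clash x y) M ×
            (∀ {x} → x ∈ xs → ∃ λ y → y ∈ M × Clash x y)
  maximal [] = [] , (λ ()) , [] , λ ()
  maximal (x ∷ xs) with maximal xs
  ... | M , M⊆ , disj , max with any? (clash? x) M
  ... | yes p = M , there ∘ M⊆ , disj , λ { (here refl) → find p ; (there x∈) → max x∈ }
  ... | no ¬p = x ∷ M , (λ { (here refl) → here refl ; (there y∈) → there (M⊆ y∈) }) ,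
                All.tabulate (λ y∈ c → ¬p (lose y∈ c)) ∷ disj ,
                λ { (here refl) → x , here refl , inj₁ (inj₁ (inj₁ refl))
                  ; (there x∈) → let y , y∈ , c = max x∈ in y , there y∈ , c }

  H∖ε : List (Fin N)
  H∖ε = filter (λ x → ¬? (x ≟ ε)) Hs

  M : List (Fin N)
  M = proj₁ (maximal H∖ε)

  M⊆H : ∀ {y} → y ∈ M → y ∈ₛ H
  M⊆H y∈ = elements⁻ H (proj₁ (∈-filter⁻ (λ x → ¬? (x ≟ ε)) {xs = Hs} (proj₁ (proj₂ (maximal H∖ε)) y∈)))

  M≢ε : ∀ {y} → y ∈ M → y ≢ ε
  M≢ε y∈ = proj₂ (∈-filter⁻ (λ x → ¬? (x ≟ ε)) {xs = Hs} (proj₁ (proj₂ (maximal H∖ε)) y∈))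

  M-max : ∀ {x} → x ∈ₛ H → x ≢ ε → ∃ λ y → y ∈ M × Clash x y
  M-max x∈ x≢ = proj₂ (proj₂ (proj₂ (maximal H∖ε))) (∈-filter⁺ (λ x → ¬? (x ≟ ε)) (elements⁺ x∈) x≢)

  near-unique : ∀ {y y′ z} → y ∈ M → y′ ∈ M → Near y z → Near y′ z → y ≡ y′
  near-unique y∈ y′∈ n n′ with ∈-AllPairs₂ (proj₁ (proj₂ (proj₂ (maximal H∖ε)))) y∈ y′∈
  ... | inj₁ eq = eq
  ... | inj₂ (inj₁ ¬c) = contradiction (near⇒clash n n′) ¬c
  ... | inj₂ (inj₂ ¬c) = contradiction (near⇒clash n′ n) ¬c

  rep : Fin N → Fin N
  rep z with z Finₚ.≤? (z ⁻¹)
  ... | yes _ = z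
  ... | no _  = z ⁻¹

  rep-~ : ∀ z → z ~ rep z
  rep-~ z with z Finₚ.≤? (z ⁻¹)
  ... | yes _ = inj₁ refl
  ... | no _  = inj₂ (sym (⁻¹-involutive z))

  rep-⁻¹ : ∀ z → rep (z ⁻¹) ≡ rep z
  rep-⁻¹ z with z Finₚ.≤? (z ⁻¹) | (z ⁻¹) Finₚ.≤? ((z ⁻¹) ⁻¹)
  ... | yes p | yes q = Finₚ.≤-antisym (subst ((z ⁻¹) Fin.≤_) (⁻¹-involutive z) q) p
  ... | yes p | no q  = ⁻¹-involutive z
  ... | no p  | yes q = refl
  ... | no p  | no q  = contradiction (subst ((z ⁻¹) Fin.≤_) (sym (⁻¹-involutive z)) (≰⇒≥ p)) q

  bit : Fin N → Fin N
  bit z with any? (λ y → near? y z) M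
  ... | yes p = proj₁ (find p)
  ... | no _  = rep z

  bit-near : ∀ {y z} → y ∈ M → Near y z → bit z ≡ y
  bit-near {y} {z} y∈ n with any? (λ y → near? y z) M
  ... | yes p = near-unique (proj₁ (proj₂ (find p))) y∈ (proj₂ (proj₂ (find p))) n
  ... | no ¬p = contradiction (lose y∈ n) ¬p

  -- True in both branches of `bit`, so the fibre over `i` lies in `i`, `i⁻¹`, `i²`, `i⁻²`. This is
  -- the factor 4 lost between quotients and independent bits.
  bit-fibre : ∀ z → Near (bit z) z
  bit-fibre z with any? (λ y → near? y z) M
  ... | yes p = proj₂ (proj₂ (find p))
  ... | no _  = inj₁ (rep-~ z)

  bit-⁻¹ : ∀ z → bit (z ⁻¹) ≡ bit z
  bit-⁻¹ z with any? (λ y → near? y z) M | any? (λ y → near? y (z ⁻¹)) M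
  ... | yes p | yes q = near-unique (proj₁ (proj₂ (find q))) (proj₁ (proj₂ (find p)))
                          (near-~ (~-sym ⁻¹-~) (proj₂ (proj₂ (find q)))) (proj₂ (proj₂ (find p)))
  ... | yes p | no ¬q = let y , y∈ , n = find p in contradiction (lose y∈ (near-~ ⁻¹-~ n)) ¬q
  ... | no ¬p | yes q = let y , y∈ , n = find q in contradiction (lose y∈ (near-~ (~-sym ⁻¹-~) n)) ¬p
  ... | no _  | no _  = rep-⁻¹ z

  Doubled : Fin N → Set
  Doubled z = Any (λ y → z ~ y ∙ y) M

  doubled? : ∀ z → Dec (Doubled z)
  doubled? z = any? (λ y → z ~? (y ∙ y)) M

  χ : Vec Bool N → Fin N → Bool
  χ ω z = does (doubled? z) xor Vec.lookup ω (bit z)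

  χ-⁻¹ : ∀ ω z → χ ω (z ⁻¹) ≡ χ ω z
  χ-⁻¹ ω z = cong₂ _xor_ flag (cong (Vec.lookup ω) (bit-⁻¹ z))
    where
    flag : does (doubled? (z ⁻¹)) ≡ does (doubled? z)
    flag with doubled? z
    ... | yes p = dec-true (doubled? (z ⁻¹)) (Any.map (~-trans ⁻¹-~) p)
    ... | no ¬p = dec-false (doubled? (z ⁻¹)) (λ q → ¬p (Any.map (~-trans (~-sym ⁻¹-~)) q))

  χ-~ : ∀ ω {u v} → u ~ v → χ ω u ≡ χ ω v
  χ-~ ω (inj₁ refl) = refl
  χ-~ ω {v = v} (inj₂ refl) = χ-⁻¹ ω v

  χ-pair : ∀ ω {y} → y ∈ M → χ ω (y ∙ y) ≢ χ ω y
  χ-pair ω {y} y∈ eq = not-¬ (trans (sym (cong₂ _xor_ (dec-true (doubled? (y ∙ y)) (lose y∈ (inj₁ refl))) (cong (Vec.lookup ω) (bit-near y∈ (inj₂ (inj₁ refl))))))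
      (trans eq (cong₂ _xor_ (dec-false (doubled? y) undoubled) (cong (Vec.lookup ω) (bit-near y∈ (inj₁ (inj₁ refl)))))))
    where
    not-¬ : ∀ {b} → not b ≢ b
    not-¬ {true} ()
    not-¬ {false} ()
    undoubled : ¬ Doubled y
    undoubled p with find p
    ... | y′ , y′∈ , n with near-unique y∈ y′∈ (inj₁ (inj₁ refl)) (inj₂ n)
    ... | refl = y≁y² (M⊆H y∈) (M≢ε y∈) n

  -- By maximality a chosen `{±y, ±2y}` meets `{±2x, ±4x}`; since halving is unique up to sign, it
  -- consists of two consecutive terms of `x, 2x, 4x, 8x` up to sign. Maximality is applied at `2x`
  -- to leave room for one halving and one doubling.
  χ-dyadic : ∀ ω {x} c → x ∈ₛ H → x ≢ ε → let x² = x ∙ x ; x⁴ = x² ∙ x² in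
             χ ω x ≡ c → χ ω x² ≡ c → χ ω x⁴ ≡ c → χ ω (x⁴ ∙ x⁴) ≡ c → ⊥
  χ-dyadic ω {x} c x∈ x≢ e₁ e₂ e₄ e₈ with M-max (∙H x∈ x∈) (λ e → x≢ (no-order-2 x∈ e))
  ... | y , y∈ , clash = go clash
    where
    pair : ∀ {u} → u ~ y → χ ω u ≡ c → χ ω (u ∙ u) ≡ c → ⊥
    pair u~y e e′ = χ-pair ω y∈ (trans (sym (χ-~ ω (~-² u~y))) (trans e′ (trans (sym e) (χ-~ ω u~y))))
    go : Clash (x ∙ x) y → ⊥
    go (inj₁ (inj₁ x²~y))  = pair x²~y e₂ e₄
    go (inj₁ (inj₂ x²~y²)) = pair (~-√ x∈ (M⊆H y∈) x²~y²) e₁ e₂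
    go (inj₂ (inj₁ x⁴~y))  = pair x⁴~y e₄ e₈
    go (inj₂ (inj₂ x⁴~y²)) = pair (~-√ (∙H x∈ x∈) (M⊆H y∈) x⁴~y²) e₂ e₄

does-true : {P : Set} (d : Dec P) → does d ≡ true → P
does-true (yes p) _ = p

-- Counting bit vectors

ones : ∀ {M} → (Vec Bool M → Bool) → ℕ
ones {zero}  P = if P [] then 1 else 0
ones {suc M} P = ones (P ∘ (true ∷_)) + ones (P ∘ (false ∷_))

ones-none : ∀ {M} (P : Vec Bool M → Bool) → (∀ ω → P ω ≢ true) → ones P ≡ 0
ones-none {zero} P none with P [] in eq
... | true  = contradiction eq (none [])
... | false = refl
ones-none {suc M} P none = cong₂ _+_ (ones-none (P ∘ (true ∷_)) (λ ω → none (true ∷ ω)))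
                                       (ones-none (P ∘ (false ∷_)) (λ ω → none (false ∷ ω)))

-- At a forced coordinate one of the two half-cubes contributes nothing, which pays for one factor
-- 2.
ones-forced : ∀ {M} (P : Vec Bool M → Bool) (J : Subset M) →
              (∀ {i} → i ∈ₛ J → ∃ λ t → ∀ ω → P ω ≡ true → Vec.lookup ω i ≡ t) →
              ones P * 2 ^ ∣ J ∣ ≤ 2 ^ M
ones-forced P [] h with P []
... | true  = ≤-refl
... | false = z≤n
ones-forced {suc M} P (outside ∷ J) h = begin
  (ones (P ∘ (true ∷_)) + ones (P ∘ (false ∷_))) * 2 ^ ∣ J ∣
    ≡⟨ *-distribʳ-+ (2 ^ ∣ J ∣) (ones (P ∘ (true ∷_))) _ ⟩
  ones (P ∘ (true ∷_)) * 2 ^ ∣ J ∣ + ones (P ∘ (false ∷_)) * 2 ^ ∣ J ∣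
    ≤⟨ +-mono-≤ (half true) (half false) ⟩
  2 ^ M + 2 ^ M
    ≡⟨ cong (2 ^ M +_) (sym (+-identityʳ (2 ^ M))) ⟩
  2 ^ suc M ∎
  where
  open ≤-Reasoning
  half : ∀ b → ones (P ∘ (b ∷_)) * 2 ^ ∣ J ∣ ≤ 2 ^ M
  half b = ones-forced (P ∘ (b ∷_)) J λ i∈ → let t , f = h (Vec.there i∈) in t , λ ω e → f (b ∷ ω) e
ones-forced {suc M} P (inside ∷ J) h = begin
  (ones (P ∘ (true ∷_)) + ones (P ∘ (false ∷_))) * (2 * 2 ^ ∣ J ∣)
    ≡⟨ solve 3 (λ a b e → (a :+ b) :* (con 2 :* e) := con 2 :* (a :* e :+ b :* e)) refl (ones (P ∘ (true ∷_))) (ones (P ∘ (false ∷_))) (2 ^ ∣ J ∣) ⟩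
  2 * (ones (P ∘ (true ∷_)) * 2 ^ ∣ J ∣ + ones (P ∘ (false ∷_)) * 2 ^ ∣ J ∣)
    ≤⟨ *-monoʳ-≤ 2 (one-sided (proj₁ (h Vec.here)) (proj₂ (h Vec.here))) ⟩
  2 * 2 ^ M ∎
  where
  open ≤-Reasoning
  half : ∀ b → ones (P ∘ (b ∷_)) * 2 ^ ∣ J ∣ ≤ 2 ^ M
  half b = ones-forced (P ∘ (b ∷_)) J λ i∈ → let t , f = h (Vec.there i∈) in t , λ ω e → f (b ∷ ω) e
  one-sided : ∀ t → (∀ ω → P ω ≡ true → Vec.lookup ω zero ≡ t) →
              ones (P ∘ (true ∷_)) * 2 ^ ∣ J ∣ + ones (P ∘ (false ∷_)) * 2 ^ ∣ J ∣ ≤ 2 ^ M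
  one-sided true f rewrite ones-none (P ∘ (false ∷_)) (λ ω e → contradiction (f (false ∷ ω) e) λ ()) =
    ≤-trans (≤-reflexive (+-identityʳ _)) (half true)
  one-sided false f rewrite ones-none (P ∘ (true ∷_)) (λ ω e → contradiction (f (true ∷ ω) e) λ ()) =
    half false

-- The method of conditional expectations: coordinates are fixed one at a time, always passing to a
-- half-cube on which the total stays below its size.
avoid : ∀ M (Ps : List (Vec Bool M → Bool)) → Σ[ ones ] Ps < 2 ^ M →
        ∃ λ ω → ∀ {P} → P ∈ Ps → P ω ≡ false
avoid zero Ps lt = [] , λ P∈ → none Ps lt P∈
  where
  none : ∀ Ps → Σ[ ones ] Ps < 1 → ∀ {P} → P ∈ Ps → P [] ≡ false
  none (P ∷ Ps) lt (here refl) with P []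
  ... | false = refl
  ... | true  = contradiction lt λ { (s≤s ()) }
  none (Q ∷ Ps) lt (there P∈) = none Ps (≤-<-trans (m≤n+m _ (ones Q)) lt) P∈
avoid (suc M) Ps lt with Σ[ ones ] (map (_∘ (true ∷_)) Ps) <? 2 ^ M
... | yes lt′ = let ω , f = avoid M _ lt′ in true ∷ ω , λ P∈ → f (∈-map⁺ (_∘ (true ∷_)) P∈)
... | no ¬lt  = let ω , f = avoid M _ lt′ in false ∷ ω , λ P∈ → f (∈-map⁺ (_∘ (false ∷_)) P∈)
  where
  open ≤-Reasoning
  split : ∀ Ps → Σ[ ones ] Ps ≡ Σ[ ones ] (map (_∘ (true ∷_)) Ps) + Σ[ ones ] (map (_∘ (false ∷_)) Ps)
  split Ps = trans (Σ-+ (ones ∘ (_∘ (true ∷_))) (ones ∘ (_∘ (false ∷_))) Ps)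
                   (cong₂ _+_ (cong sum (map-∘ Ps)) (cong sum (map-∘ Ps)))
  lt′ : Σ[ ones ] (map (_∘ (false ∷_)) Ps) < 2 ^ M
  lt′ = +-cancelˡ-< (2 ^ M) _ _ (begin-strict
    2 ^ M + Σ[ ones ] (map (_∘ (false ∷_)) Ps)
      ≤⟨ +-monoˡ-≤ _ (≮⇒≥ ¬lt) ⟩
    Σ[ ones ] (map (_∘ (true ∷_)) Ps) + Σ[ ones ] (map (_∘ (false ∷_)) Ps)
      ≡⟨ sym (split Ps) ⟩
    Σ[ ones ] Ps
      <⟨ lt ⟩
    2 ^ M + (2 ^ M + 0)
      ≡⟨ cong (2 ^ M +_) (+-identityʳ (2 ^ M)) ⟩
    2 ^ M + 2 ^ M ∎)

-- Sums over concatenations, and lists of tuples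

Σ-concatMap : {X Y : Set} (f : Y → ℕ) (g : X → List Y) (xs : List X) →
              Σ[ f ] (concatMap g xs) ≡ Σ[ (λ x → Σ[ f ] (g x)) ] xs
Σ-concatMap f g [] = refl
Σ-concatMap f g (x ∷ xs) = trans (cong sum (map-++ f (g x) (concatMap g xs)))
  (trans (sum-++ (map f (g x)) _) (cong (Σ[ f ] (g x) +_) (Σ-concatMap f g xs)))

length-concatMap-≤ : {X Y : Set} (g : X → List Y) {c : ℕ} (xs : List X) →
                     (∀ {x} → x ∈ xs → length (g x) ≤ c) → length (concatMap g xs) ≤ length xs * c
length-concatMap-≤ g [] h = z≤n
length-concatMap-≤ g (x ∷ xs) h = ≤-trans (≤-reflexive (length-++ (g x)))
  (+-mono-≤ (h (here refl)) (length-concatMap-≤ g xs (h ∘ there)))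

tuples : {X : Set} → List X → ℕ → List (List X)
tuples xs zero    = [] ∷ []
tuples xs (suc n) = cartesianProductWith _∷_ xs (tuples xs n)

length-tuples : {X : Set} (xs : List X) (n : ℕ) → length (tuples xs n) ≡ length xs ^ n
length-tuples xs zero    = refl
length-tuples xs (suc n) = trans (length-cartesianProductWith _∷_ xs (tuples xs n)) (cong (length xs *_) (length-tuples xs n))

tuples⁺ : {X : Set} {xs zs : List X} → (∀ {z} → z ∈ zs → z ∈ xs) → zs ∈ tuples xs (length zs)
tuples⁺ {zs = []}     h = here refl
tuples⁺ {zs = z ∷ zs} h = ∈-cartesianProductWith⁺ _∷_ (h (here refl)) (tuples⁺ (h ∘ there))

tuples⁻ : {X : Set} (xs : List X) (n : ℕ) {zs : List X} → zs ∈ tuples xs n → length zs ≡ n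
tuples⁻ xs zero (here refl) = refl
tuples⁻ xs (suc n) z∈ with ∈-cartesianProductWith⁻ _∷_ xs (tuples xs n) z∈
... | z , zs , _ , zs∈ , refl = cong suc (tuples⁻ xs n zs∈)

-- Makes membership in `H` a proposition, so that elements of the subtype `HG` are equal once their
-- underlying group elements are.
[]=-irrelevant : ∀ {A : Set} {n} {xs : Vec A n} {i x} (p q : xs Vec.[ i ]= x) → p ≡ q
[]=-irrelevant Vec.here      Vec.here      = refl
[]=-irrelevant (Vec.there p) (Vec.there q) = cong Vec.there ([]=-irrelevant p q)

-- Monochromatic sets and the bits they force

module Existence {N : ℕ} (G : FiniteGroup N) (H : Subset N)
                 (isAbelian : IsAbelianSubgroup G H) (coprime : Coprime ∣ H ∣ 6) where

  open FiniteGroup G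
  open IsGroup isGroup using (inverseʳ)
  open GroupTheory _≟_ isGroup
  open Colouring G H isAbelian coprime
  open Groupₚ Gp using (∙-cancelʳ)
  open DecMembership (_≟_ {N}) using (_∈?_)

  transversal : ∃ λ Tr → length Tr * ∣ H ∣ ≤ N × (∀ v → ∃ λ x → x ∈ Tr × (v ∙ (x ⁻¹)) ∈ₛ H)
  transversal = B , subst₂ (λ h n → length B * h ≤ n) (length-elements H) (length-tabulate (λ x → x)) (proj₁ (proj₂ (proj₂ greedy))) , cover
    where
    open Greedy _≟_ (λ v h → h ∙ v) (λ v eq → ∙-cancelʳ v _ _ eq) Hs (elements! H) (allFin N) (Unq.allFin⁺ N) (allFin N)
                (λ _ _ → ∈-allFin _) (length Hs) (∈-length (elements⁺ εH))
    B = proj₁ greedy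
    cover : ∀ v → ∃ λ x → x ∈ B × (v ∙ (x ⁻¹)) ∈ₛ H
    cover v =
      let pos = +-cancelʳ-≤ (new B v) 1 _ (≤-trans (proj₂ (proj₂ (proj₂ greedy)) (∈-allFin v))
                    (≤-reflexive (sym (cnt-∁ (λ h → covered? B (h ∙ v)) Hs))))
          h , h∈ , cov = cnt-witness (λ h → covered? B (h ∙ v)) Hs pos
          b , b∈ , cov′ = find cov
          h′ , h′∈ , eq = find cov′
      in b , b∈ , subst (_∈ₛ H)
           (trans (by-reduction (h ∷ h′ ∷ b ∷ []) (inv (var 0F) ⊗ var 1F) (inv (var 0F) ⊗ ((var 1F ⊗ var 2F) ⊗ inv (var 2F))) refl)
           (trans (cong (λ z → (h ⁻¹) ∙ (z ∙ (b ⁻¹))) eq)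
             (by-reduction (h ∷ v ∷ b ∷ []) (inv (var 0F) ⊗ ((var 0F ⊗ var 1F) ⊗ inv (var 2F))) (var 1F ⊗ inv (var 2F)) refl)))
           (∙H (⁻¹H (elements⁻ H h∈)) (elements⁻ H h′∈))

  Mono : List (Fin N) → Bool → Vec Bool N → Set
  Mono A c ω = All (λ x → All (λ y → x ≡ y ⊎ χ ω (x ∙ (y ⁻¹)) ≡ c) A) A

  mono? : ∀ A c ω → Dec (Mono A c ω)
  mono? A c ω = All.all? (λ x → All.all? (λ y → (x ≟ y) ⊎-dec (χ ω (x ∙ (y ⁻¹)) Boolₚ.≟ c)) A) A

  quots : List (Fin N) → List (Fin N)
  quots A = deduplicate _≟_ (cartesianProductWith (λ x y → x ∙ (y ⁻¹)) A A)

  quots! : ∀ A → Unique (quots A)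
  quots! A = UnqDec.deduplicate-! _≟_ _

  quots⁺ : ∀ {A x y} → x ∈ A → y ∈ A → (x ∙ (y ⁻¹)) ∈ quots A
  quots⁺ x∈ y∈ = ∈-deduplicate⁺ _≟_ (∈-cartesianProductWith⁺ _ x∈ y∈)

  quots⁻ : ∀ A {z} → z ∈ quots A → ∃₂ λ x y → x ∈ A × y ∈ A × z ≡ x ∙ (y ⁻¹)
  quots⁻ A z∈ = ∈-cartesianProductWith⁻ (λ x y → x ∙ (y ⁻¹)) A A (∈-deduplicate⁻ _≟_ (cartesianProductWith (λ x y → x ∙ (y ⁻¹)) A A) z∈)

  ≢⇒quot≢ε : ∀ {x y} → x ≢ y → x ∙ (y ⁻¹) ≢ ε
  ≢⇒quot≢ε {x} {y} x≢y e = x≢y (∙-cancelʳ (y ⁻¹) x y (trans e (sym (inverseʳ y))))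

  mono-χ : ∀ {A c ω x y} → Mono A c ω → x ∈ A → y ∈ A → x ≢ y → χ ω (x ∙ (y ⁻¹)) ≡ c
  mono-χ mono x∈ y∈ x≢y with All.lookup (All.lookup mono x∈) y∈
  ... | inj₁ e = contradiction e x≢y
  ... | inj₂ e = e

  bits : List (Fin N) → List (Fin N)
  bits A = deduplicate _≟_ (map bit (filter (λ z → ¬? (z ≟ ε)) (quots A)))

  quots≤bits : ∀ A → length (quots A) ≤ suc (length (bits A) * 4)
  quots≤bits A = ≤-trans (⊆⇒length≤ (quots! A) sub)
      (≤-reflexive (cong suc (length-cartesianProductWith (λ i f → f i) (bits A) fs)))
    where
    fs : List (Fin N → Fin N)
    fs = (λ i → i) ∷ _⁻¹ ∷ (λ i → i ∙ i) ∷ (λ i → (i ∙ i) ⁻¹) ∷ []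
    sub : ∀ {z} → z ∈ quots A → z ∈ ε ∷ cartesianProductWith (λ i f → f i) (bits A) fs
    sub {z} z∈ with z ≟ ε
    ... | yes e = here e
    ... | no z≢ = there (near (bit-fibre z))
      where
      b∈ : bit z ∈ bits A
      b∈ = ∈-deduplicate⁺ _≟_ (∈-map⁺ bit (∈-filter⁺ (λ z → ¬? (z ≟ ε)) z∈ z≢))
      app : ∀ {f} → f ∈ fs → f (bit z) ∈ cartesianProductWith (λ i f → f i) (bits A) fs
      app = ∈-cartesianProductWith⁺ (λ i f → f i) b∈
      near : Near (bit z) z → z ∈ cartesianProductWith (λ i f → f i) (bits A) fs
      near (inj₁ (inj₁ e)) = subst (_∈ _) (sym e) (app (here refl))
      near (inj₁ (inj₂ e)) = subst (_∈ _) (sym e) (app (there (here refl)))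
      near (inj₂ (inj₁ e)) = subst (_∈ _) (sym e) (app (there (there (here refl))))
      near (inj₂ (inj₂ e)) = subst (_∈ _) (sym e) (app (there (there (there (here refl)))))

  event : List (Fin N) → Bool → Vec Bool N → Bool
  event A c ω = does (mono? A c ω)

  -- Each nontrivial quotient `z` of `A` must have colour `c`, which fixes the coordinate `bit z` to
  -- `c`, flipped when `z` is doubled.
  ones-event : ∀ A c → ones (event A c) * 2 ^ (length (quots A) / 4) ≤ 2 ^ N
  ones-event A c = ≤-trans (*-monoʳ-≤ (ones (event A c)) (^-monoʳ-≤ 2 enough)) (ones-forced (event A c) J forced)
    where
    J : Subset N
    J = Vec.tabulate (λ i → does (i ∈? bits A))
    J⁺ : ∀ {i} → i ∈ bits A → i ∈ₛ J
    J⁺ {i} i∈ = lookup⇒[]= i J (trans (lookup∘tabulate _ i) (dec-true (i ∈? bits A) i∈))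
    J⁻ : ∀ {i} → i ∈ₛ J → i ∈ bits A
    J⁻ {i} i∈ = does-true (i ∈? bits A) (trans (sym (lookup∘tabulate (λ i → does (i ∈? bits A)) i)) ([]=⇒lookup i∈))
    enough : length (quots A) / 4 ≤ ∣ J ∣
    enough = ≤-trans quarter (subst (length (bits A) ≤_) (length-elements J)
               (⊆⇒length≤ (UnqDec.deduplicate-! _≟_ _) (elements⁺ ∘ J⁺)))
      where
      open ≤-Reasoning
      quarter : length (quots A) / 4 ≤ length (bits A)
      -- The quotient `ε` forces no bit; rounding the quarter down absorbs this one element.
      quarter = ≤-pred (*-cancelʳ-< 4 _ _ (begin-strict
        length (quots A) / 4 * 4        ≤⟨ m/n*n≤m (length (quots A)) 4 ⟩
        length (quots A)                ≤⟨ quots≤bits A ⟩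
        1 + length (bits A) * 4         <⟨ +-monoˡ-< (length (bits A) * 4) {1} {4} (s≤s (s≤s z≤n)) ⟩
        suc (length (bits A)) * 4       ∎))
    forced : ∀ {i} → i ∈ₛ J → ∃ λ t → ∀ ω → event A c ω ≡ true → Vec.lookup ω i ≡ t
    forced i∈ with ∈-map⁻ bit (∈-deduplicate⁻ _≟_ _ (J⁻ i∈))
    ... | z , z∈ , refl with ∈-filter⁻ (λ z → ¬? (z ≟ ε)) {xs = quots A} z∈
    ... | z∈q , z≢ with quots⁻ A z∈q
    ... | x , y , x∈ , y∈ , refl = does (doubled? z) xor c , λ ω e →
            xor-solve (does (doubled? z)) (mono-χ {ω = ω} (does-true (mono? A c ω) e) x∈ y∈ λ { refl → z≢ (inverseʳ x) })
      where
      xor-solve : ∀ a {b c} → a xor b ≡ c → b ≡ a xor c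
      xor-solve false refl = refl
      xor-solve true {b} refl = sym (Boolₚ.not-involutive b)

-- The union bound over spelled sets

module Union {N : ℕ} (G : FiniteGroup N) (H : Subset N)
             (isAbelian : IsAbelianSubgroup G H) (coprime : Coprime ∣ H ∣ 6)
             (Tr : List (Fin N))
             (transv : ∀ v → ∃ λ x → x ∈ Tr × FiniteGroup._∙_ G v (FiniteGroup._⁻¹ G x) ∈ₛ H) where

  open FiniteGroup G
  open IsGroup isGroup using (assoc; identityˡ; identityʳ; inverseˡ; inverseʳ)
  open GroupTheory _≟_ isGroup
  open Colouring G H isAbelian coprime
  open Existence G H isAbelian coprime
  open Groupₚ Gp using (∙-cancelʳ)

  HG : Set
  HG = Σ (Fin N) (_∈ₛ H)

  HG-≡ : {a b : HG} → proj₁ a ≡ proj₁ b → a ≡ b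
  HG-≡ {_ , p} {_ , q} refl = cong (_ ,_) ([]=-irrelevant p q)

  HG-≟ : DecidableEquality HG
  HG-≟ a b with proj₁ a ≟ proj₁ b
  ... | yes e = yes (HG-≡ e)
  ... | no ¬e = no (¬e ∘ cong proj₁)

  _·_ : HG → HG → HG
  (x , x∈) · (y , y∈) = x ∙ y , ∙H x∈ y∈

  invH : HG → HG
  invH (x , x∈) = x ⁻¹ , ⁻¹H x∈

  HG-isAbelianGroup : IsAbelianGroup _≡_ _·_ (ε , εH) invH
  HG-isAbelianGroup = record
    { isGroup = record
      { isMonoid = record
        { isSemigroup = record
          { isMagma = record { isEquivalence = isEquivalence ; ∙-cong = cong₂ _·_ }
          ; assoc = λ a b c → HG-≡ (assoc (proj₁ a) (proj₁ b) (proj₁ c)) }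
        ; identity = (λ a → HG-≡ (identityˡ (proj₁ a))) , (λ a → HG-≡ (identityʳ (proj₁ a))) }
      ; inverse = (λ a → HG-≡ (inverseˡ (proj₁ a))) , (λ a → HG-≡ (inverseʳ (proj₁ a)))
      ; ⁻¹-cong = cong invH }
    ; comm = λ a b → HG-≡ (commH (proj₂ a) (proj₂ b)) }

  m : ℕ
  m = length Tr

  -- This is `n^26 ≤ m^26 4^11 T^25`, left in the shape that `dyadic-quotients` delivers for a part
  -- of `A` with at least `n / m` elements.
  Large : ℕ → ℕ → Set
  Large n T = n ^ 4 * (n * n) ^ 11 ≤ m ^ 4 * (m * m) ^ 11 * ((4 * (T * T)) ^ 11 * T ^ 3)

  -- `D` is the part of `A` in a popular coset `H x`, moved into `H`. In quotients `x` cancels, so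
  -- nontrivial quotients of `D` are quotients of `A` and have colour `c`; if there were too few,
  -- `dyadic-quotients` would contradict `χ-dyadic`.
  mono-large : ∀ {A c ω} → Unique A → 1 ≤ length A → Mono A c ω → Large (length A) (length (quots A))
  mono-large {A} {c} {ω} A! 1≤A mono with popular (λ v x → (v ∙ (x ⁻¹)) ∈ₛ? H) {A} Tr 1≤A (λ {v} _ → transv v)
  ... | x , _ , A≤mA₁ with choose {R = λ v h → proj₁ h ≡ v ∙ (x ⁻¹)}
                             (All.tabulate {xs = filter (λ v → (v ∙ (x ⁻¹)) ∈ₛ? H) A}
                               (λ {v} v∈ → (v ∙ (x ⁻¹) , proj₂ (∈-filter⁻ (λ v → (v ∙ (x ⁻¹)) ∈ₛ? H) {xs = A} v∈)) , refl))
  ... | D , ptw = conclude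
    where
    open ≤-Reasoning
    d = length D
    T = length (quots A)
    D⇒A : ∀ {h} → h ∈ D → ∃ λ v → v ∈ A × proj₁ h ≡ v ∙ (x ⁻¹)
    D⇒A h∈ = let v , v∈ , e = pointwise-∈ ptw h∈
             in v , proj₁ (∈-filter⁻ (λ v → (v ∙ (x ⁻¹)) ∈ₛ? H) {xs = A} v∈) , e
    D! : Unique D
    D! = pointwise-AllPairs (λ {v} {v′} v≢ e e′ h≡ → v≢ (∙-cancelʳ (x ⁻¹) v v′ (trans (sym e) (trans (cong proj₁ h≡) e′))))
           ptw (Unq.filter⁺ (λ v → (v ∙ (x ⁻¹)) ∈ₛ? H) A!)
    n≤md : length A ≤ m * d
    n≤md = ≤-trans A≤mA₁ (≤-reflexive (cong (m *_) (Pointwise-length ptw)))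
    1≤D : 1 ≤ d
    1≤D = positiveʳ m (≤-trans 1≤A n≤md)
    D-quot : ∀ {h h′} → h ∈ D → h′ ∈ D → ∃₂ λ v v′ → v ∈ A × v′ ∈ A × proj₁ (h · invH h′) ≡ v ∙ (v′ ⁻¹)
    D-quot h∈ h′∈ with D⇒A h∈ | D⇒A h′∈
    ... | v , v∈ , refl | v′ , v′∈ , refl = v , v′ , v∈ , v′∈ ,
      by-reduction (v ∷ v′ ∷ x ∷ []) ((var 0F ⊗ inv (var 2F)) ⊗ inv (var 1F ⊗ inv (var 2F))) (var 0F ⊗ inv (var 1F)) refl
    Qt : List HG
    Qt = deduplicate HG-≟ (cartesianProductWith (λ a b → a · invH b) D D)
    Qt! : Unique Qt
    Qt! = UnqDec.deduplicate-! HG-≟ _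
    Qt≤T : length Qt ≤ T
    Qt≤T = inj-≤ (λ h z → proj₁ h ≡ z) Qt! image (λ e e′ → HG-≡ (trans e (sym e′)))
      where
      image : ∀ {h} → h ∈ Qt → ∃ λ z → z ∈ quots A × proj₁ h ≡ z
      image h∈ with ∈-cartesianProductWith⁻ _ D D (∈-deduplicate⁻ HG-≟ (cartesianProductWith _ D D) h∈)
      ... | a , b , a∈ , b∈ , refl = let v , v′ , v∈ , v′∈ , e = D-quot a∈ b∈ in
            _ , subst (_∈ quots A) (sym e) (quots⁺ v∈ v′∈) , refl
    open Dilates HG-≟ HG-isAbelianGroup D D! 1≤D Qt Qt!
           (λ a∈ b∈ → ∈-deduplicate⁺ HG-≟ (∈-cartesianProductWith⁺ (λ a b → a · invH b) a∈ b∈))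
      using (IsQuotient; DyadicQuotients; dyadic-quotients)
    χ-D : ∀ {h h′} → h ∈ D → h′ ∈ D → proj₁ (h · invH h′) ≢ ε → χ ω (proj₁ (h · invH h′)) ≡ c
    χ-D h∈ h′∈ ≢ε = let v , v′ , v∈ , v′∈ , e = D-quot h∈ h′∈ in
      trans (cong (χ ω) e) (mono-χ {ω = ω} mono v∈ v′∈ λ v≡v′ → ≢ε (trans e (trans (cong (_∙ (v′ ⁻¹)) v≡v′) (inverseʳ v′))))
    χ-quot : ∀ {z w} → IsQuotient z → proj₁ z ≡ w → w ≢ ε → χ ω w ≡ c
    χ-quot (a , b , a∈ , b∈ , refl) refl w≢ = χ-D a∈ b∈ w≢
    impossible : DyadicQuotients → ⊥
    impossible (a , b , a∈ , b∈ , a≢b , q₂ , q₄ , q₈) =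
      χ-dyadic ω c u∈ u≢ (χ-D a∈ b∈ u≢)
        (χ-quot q₂ (cong (_∙ u) (identityˡ u)) u²≢)
        (χ-quot q₄ (trans (cong (λ z → ((z ∙ u) ∙ u) ∙ u) (identityˡ u))
          (by-reduction (u ∷ []) (((var 0F ⊗ var 0F) ⊗ var 0F) ⊗ var 0F) ((var 0F ⊗ var 0F) ⊗ (var 0F ⊗ var 0F)) refl)) u⁴≢)
        (χ-quot q₈ (trans (cong (λ z → ((((((z ∙ u) ∙ u) ∙ u) ∙ u) ∙ u) ∙ u) ∙ u) (identityˡ u))
          (by-reduction (u ∷ []) (((((((var 0F ⊗ var 0F) ⊗ var 0F) ⊗ var 0F) ⊗ var 0F) ⊗ var 0F) ⊗ var 0F) ⊗ var 0F)
             (((var 0F ⊗ var 0F) ⊗ (var 0F ⊗ var 0F)) ⊗ ((var 0F ⊗ var 0F) ⊗ (var 0F ⊗ var 0F))) refl))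
          (λ e → u⁴≢ (no-order-2 (∙H (∙H u∈ u∈) (∙H u∈ u∈)) e)))
      where
      u = proj₁ (a · invH b)
      u∈ : u ∈ₛ H
      u∈ = proj₂ (a · invH b)
      u≢ : u ≢ ε
      u≢ = ≢⇒quot≢ε (a≢b ∘ HG-≡)
      u²≢ : u ∙ u ≢ ε
      u²≢ e = u≢ (no-order-2 u∈ e)
      u⁴≢ : (u ∙ u) ∙ (u ∙ u) ≢ ε
      u⁴≢ e = u²≢ (no-order-2 (∙H u∈ u∈) e)
    bound : ℕ → ℕ
    bound t = (4 * (t * t)) ^ 11 * t ^ 3
    bound-mono : ∀ {t t′} → t ≤ t′ → bound t ≤ bound t′
    bound-mono t≤ = *-mono-≤ (^-monoˡ-≤ 11 (*-monoʳ-≤ 4 (*-mono-≤ t≤ t≤))) (^-monoˡ-≤ 3 t≤)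
    d-bound : d ^ 4 * (d * d) ^ 11 ≤ bound T
    d-bound with bound (length Qt) <? d ^ 4 * (d * d) ^ 11
    ... | yes lt = ⊥-elim (impossible (dyadic-quotients lt))
    ... | no ¬lt = ≤-trans (≮⇒≥ ¬lt) (bound-mono Qt≤T)
    conclude : Large (length A) T
    conclude = begin
      length A ^ 4 * (length A * length A) ^ 11
        ≤⟨ *-mono-≤ (^-monoˡ-≤ 4 n≤md) (^-monoˡ-≤ 11 (*-mono-≤ n≤md n≤md)) ⟩
      (m * d) ^ 4 * (m * d * (m * d)) ^ 11
        ≡⟨ cong (λ z → (m * d) ^ 4 * z ^ 11) (solve 2 (λ m d → m :* d :* (m :* d) := m :* m :* (d :* d)) refl m d) ⟩
      (m * d) ^ 4 * (m * m * (d * d)) ^ 11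
        ≡⟨ cong₂ _*_ (*-^ m d 4) (*-^ (m * m) (d * d) 11) ⟩
      m ^ 4 * d ^ 4 * ((m * m) ^ 11 * (d * d) ^ 11)
        ≡⟨ solve 4 (λ a b c e → a :* b :* (c :* e) := a :* c :* (b :* e)) refl (m ^ 4) (d ^ 4) ((m * m) ^ 11) ((d * d) ^ 11) ⟩
      m ^ 4 * (m * m) ^ 11 * (d ^ 4 * (d * d) ^ 11)
        ≤⟨ *-monoʳ-≤ (m ^ 4 * (m * m) ^ 11) d-bound ⟩
      m ^ 4 * (m * m) ^ 11 * bound T ∎

  module _ (q : ℕ) {{q≢0 : NonZero q}} (s : ℕ) (4q<2^s : 4 * q < 2 ^ s) where

    n k ℓ : ℕ
    n = 4 * q
    k = 2 * m * s
    ℓ = 1 + 8 * k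

    -- The generators counted in `encode`: two covers of size at most `T / q`, the transversal, one
    -- unspelled element per step, and the starting vertex.
    g : ℕ → ℕ
    g T = T / q + m + k + 1 + T / q

    codes : ℕ → ℕ
    codes T = N ^ g T * ((1 + (g T + g T)) ^ ℓ) ^ n

    family : ℕ → List (List (Fin N))
    family T = concatMap (λ S → tuples (words S ℓ) n) (tuples (allFin N) (g T))

    length-family : ∀ T → length (family T) ≤ codes T
    length-family T = ≤-trans
      (length-concatMap-≤ (λ S → tuples (words S ℓ) n) (tuples (allFin N) (g T)) λ {S} S∈ → ≤-reflexive
        (trans (length-tuples (words S ℓ) n) (cong (_^ n) (trans (length-words S ℓ)
          (cong (λ z → (1 + (z + z)) ^ ℓ) (tuples⁻ (allFin N) (g T) S∈))))))
      (≤-reflexive (cong (_* ((1 + (g T + g T)) ^ ℓ) ^ n)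
        (trans (length-tuples (allFin N) (g T)) (cong (_^ g T) (length-tabulate (λ x → x))))))

    ≤-/ : ∀ {b T} → b * q ≤ T → b ≤ T / q
    ≤-/ {b} {T} h = subst (_≤ T / q) (m*n/n≡m b q) (/-monoˡ-≤ q h)

    ∈family : ∀ {A} → Unique A → length A ≡ n → A ∈ family (length (quots A))
    ∈family {A} A! |A| = spelled (Encoding.encode (_∈ₛ H) (_∈ₛ? H) commH Tr transv A A! q (>-nonZero⁻¹ q) |A| (quots A) (quots! A)
             (quots⁺ {A}) s (subst (_< 2 ^ s) (sym |A|) 4q<2^s))
      where
      T = length (quots A)
      spelled : (∃ λ S → ∃₂ λ b c → b * q ≤ T × c * q ≤ T × length S ≤ b + m + k + 1 + c ×
                 (∀ {v} → v ∈ A → v ∈ words S ℓ)) → A ∈ family T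
      spelled (S , b , c , bq , cq , len , A⊆W) = ∈-concatMap⁺ (λ S → tuples (words S ℓ) n) (lose S⁺∈ A∈)
        where
        |S| : length S ≤ g T
        |S| = ≤-trans len (+-mono-≤ (+-monoˡ-≤ 1 (+-monoˡ-≤ k (+-monoˡ-≤ m (≤-/ {b} bq)))) (≤-/ {c} cq))
        -- Padding with `ε` makes the number of generators depend on `T` alone.
        S⁺ = S ++ replicate (g T ∸ length S) ε
        |S⁺| : length S⁺ ≡ g T
        |S⁺| = trans (length-++ S) (trans (cong (length S +_) (length-replicate (g T ∸ length S))) (m+[n∸m]≡n |S|))
        S⁺∈ : S⁺ ∈ tuples (allFin N) (g T)
        S⁺∈ = subst (λ l → S⁺ ∈ tuples (allFin N) l) |S⁺| (tuples⁺ {xs = allFin N} {zs = S⁺} (λ _ → ∈-allFin _))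
        A∈ : A ∈ tuples (words S⁺ ℓ) n
        A∈ = subst (λ l → A ∈ tuples (words S⁺ ℓ) l) |A| (tuples⁺ {xs = words S⁺ ℓ} {zs = A} (λ v∈ → words-⊆ {S} {S⁺} ∈-++⁺ˡ ℓ (A⊆W v∈)))

    large? : Decidable (Large n)
    large? T = _ ≤? _

    colours : List (Fin N) → List (Vec Bool N → Bool)
    colours A = event A true ∷ event A false ∷ []

    sized : ℕ → List (List (Fin N))
    sized T = filter (λ A → length (quots A) Data.Nat.≟ T) (family T)

    events : ℕ → List (Vec Bool N → Bool)
    events T = concatMap colours (sized T)

    -- By `mono-large` a monochromatic set has no other number of quotients, and the estimate
    -- `few-codes` is available only for these.
    sizes : List ℕ
    sizes = filter large? (upTo (suc (n * n)))

    Σ-events : ∀ T → Σ[ ones ] (events T) * 2 ^ (T / 4) ≤ 2 * codes T * 2 ^ N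
    Σ-events T = begin
      Σ[ ones ] (events T) * E     ≤⟨ Σ-bound (events T) each ⟩
      length (events T) * 2 ^ N    ≤⟨ *-monoˡ-≤ (2 ^ N) len ⟩
      2 * codes T * 2 ^ N          ∎
      where
      open ≤-Reasoning
      E = 2 ^ (T / 4)
      len : length (events T) ≤ 2 * codes T
      len = begin
        length (events T)      ≤⟨ length-concatMap-≤ colours (sized T) (λ _ → ≤-refl) ⟩
        length (sized T) * 2   ≤⟨ *-monoˡ-≤ 2 (≤-trans (length-filter _ (family T)) (length-family T)) ⟩
        codes T * 2            ≡⟨ *-comm (codes T) 2 ⟩
        2 * codes T            ∎
      each : ∀ {P} → P ∈ events T → ones P * E ≤ 2 ^ N
      each P∈ with find (∈-concatMap⁻ colours {xs = sized T} P∈)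
      ... | A , A∈ , P∈A with ∈-filter⁻ (λ A → length (quots A) Data.Nat.≟ T) {xs = family T} A∈
      each P∈ | A , A∈ , here refl         | _ , refl = ones-event A true
      each P∈ | A , A∈ , there (here refl) | _ , refl = ones-event A false
      Σ-bound : ∀ Ps → (∀ {P} → P ∈ Ps → ones P * E ≤ 2 ^ N) → Σ[ ones ] Ps * E ≤ length Ps * 2 ^ N
      Σ-bound [] h = z≤n
      Σ-bound (P ∷ Ps) h = ≤-trans (≤-reflexive (*-distribʳ-+ E (ones P) _))
        (+-mono-≤ (h (here refl)) (Σ-bound Ps (h ∘ there)))

    Result : Set
    Result = ∃ λ S → IsConnectionSet G S × (∀ K → IsClique G S K → ∣ K ∣ ≤ n) × (∀ K → IsIndependent G S K → ∣ K ∣ ≤ n)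

    module From (ω : Vec Bool N) (avoids : ∀ {P} → P ∈ concatMap events sizes → P ω ≡ false) where

      no-mono : ∀ {A c} → Unique A → length A ≡ n → ¬ Mono A c ω
      no-mono {A} {c} A! |A| mono = contradiction
          (trans (sym (dec-true (mono? A c ω) mono)) (avoids (∈-concatMap⁺ events (lose T∈ e∈)))) λ ()
        where
        T = length (quots A)
        1≤A : 1 ≤ length A
        1≤A = ≤-trans (*-mono-≤ {1} {4} (s≤s z≤n) (>-nonZero⁻¹ q)) (≤-reflexive (sym |A|))
        T≤n² : T ≤ n * n
        T≤n² = subst (λ l → T ≤ l * l) |A| (≤-trans (length-deduplicate _≟_ (cartesianProductWith (λ x y → x ∙ (y ⁻¹)) A A))
                 (≤-reflexive (length-cartesianProductWith (λ x y → x ∙ (y ⁻¹)) A A)))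
        T∈ : T ∈ sizes
        T∈ = ∈-filter⁺ large? (∈-upTo⁺ (s≤s T≤n²)) (subst (λ l → Large l T) |A| (mono-large {c = c} {ω = ω} A! 1≤A mono))
        col∈ : ∀ c → event A c ∈ colours A
        col∈ true  = here refl
        col∈ false = there (here refl)
        e∈ : event A c ∈ events T
        e∈ = ∈-concatMap⁺ colours (lose (∈-filter⁺ (λ A → length (quots A) Data.Nat.≟ T) (∈family A! |A|) refl) (col∈ c))

      -- `χ` colours `ε` as well, so the identity has to be excluded separately.
      InS : Fin N → Set
      InS z = z ≢ ε × χ ω z ≡ true

      inS? : Decidable InS
      inS? z = ¬? (z ≟ ε) ×-dec (χ ω z Boolₚ.≟ true)

      S : Subset N
      S = Vec.tabulate (λ z → does (inS? z))

      S⁺ : ∀ {z} → InS z → z ∈ₛ S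
      S⁺ {z} p = lookup⇒[]= z S (trans (lookup∘tabulate _ z) (dec-true (inS? z) p))

      S⁻ : ∀ {z} → z ∈ₛ S → InS z
      S⁻ {z} z∈ = does-true (inS? z) (trans (sym (lookup∘tabulate (λ z → does (inS? z)) z)) ([]=⇒lookup z∈))

      connection : IsConnectionSet G S
      connection = (λ ε∈ → proj₁ (S⁻ ε∈) refl) , λ x x∈ → let x≢ , e = S⁻ x∈ in
        S⁺ ((λ e′ → x≢ (trans (sym (⁻¹-involutive x)) (trans (cong _⁻¹ e′) ε⁻¹≈ε))) , trans (χ-⁻¹ ω x) e)
        where open Groupₚ Gp using (⁻¹-involutive; ε⁻¹≈ε)

      small : ∀ c K → (∀ x y → x ∈ₛ K → y ∈ₛ K → x ≢ y → χ ω (x ∙ (y ⁻¹)) ≡ c) → ∣ K ∣ ≤ n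
      small c K h with n ≤? ∣ K ∣
      ... | no n≰ = <⇒≤ (≰⇒> n≰)
      ... | yes n≤ = contradiction mono (no-mono {A} {c} (Unq.take⁺ n (elements! K)) |A|)
        where
        A = take n (elements K)
        |A| : length A ≡ n
        |A| = trans (length-take n (elements K)) (m≤n⇒m⊓n≡m (subst (n ≤_) (sym (length-elements K)) n≤))
        take⊆ : ∀ (j : ℕ) {xs : List (Fin N)} {x} → x ∈ take j xs → x ∈ xs
        take⊆ (suc j) {_ ∷ _} (here e)   = here e
        take⊆ (suc j) {_ ∷ _} (there x∈) = there (take⊆ j x∈)
        A⊆K : ∀ {x} → x ∈ A → x ∈ₛ K
        A⊆K x∈ = elements⁻ K (take⊆ n x∈)
        mono : Mono A c ω
        mono = All.tabulate λ {x} x∈ → All.tabulate λ {y} y∈ → dec (x ≟ y) (A⊆K x∈) (A⊆K y∈)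
          where
          dec : ∀ {x y} → Dec (x ≡ y) → x ∈ₛ K → y ∈ₛ K → x ≡ y ⊎ χ ω (x ∙ (y ⁻¹)) ≡ c
          dec (yes e) _ _ = inj₁ e
          dec (no ¬e) x∈ y∈ = inj₂ (h _ _ x∈ y∈ ¬e)

      result : Result
      result = S , connection ,
        (λ K clique → small true K (λ x y x∈ y∈ x≢ → proj₂ (S⁻ (clique x y x∈ y∈ x≢)))) ,
        (λ K indep → small false K (λ x y x∈ y∈ x≢ →
          Boolₚ.¬-not (λ e → indep x y x∈ y∈ x≢ (S⁺ (≢⇒quot≢ε x≢ , e)))))

    module _ (few-codes : ∀ T → T ≤ n * n → Large n T → (2 + n * n) * (2 * codes T) ≤ 2 ^ (T / 4)) where

      Σ-all : Σ[ ones ] (concatMap events sizes) < 2 ^ N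
      Σ-all = subst (_< 2 ^ N) (sym (Σ-concatMap ones events sizes)) (*-cancelʳ-< (2 + n * n) _ _ (begin-strict
        Σ[ σ ] sizes * (2 + n * n)      ≡⟨ Σ-*  sizes ⟩
        Σ[ (λ T → σ T * (2 + n * n)) ] sizes
          ≤⟨ Σ-upper sizes each ⟩
        length sizes * 2 ^ N
          -- There are at most `1 + n * n` sizes; the factor `2 + n * n` is one larger and so gives
          -- strictness.
          <⟨ *-monoˡ-< (2 ^ N) {{m^n≢0 2 N}} (≤-<-trans (≤-trans (length-filter large? (upTo (suc (n * n)))) (≤-reflexive (length-upTo (suc (n * n))))) ≤-refl) ⟩
        (2 + n * n) * 2 ^ N             ≡⟨ *-comm (2 + n * n) (2 ^ N) ⟩
        2 ^ N * (2 + n * n)             ∎))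
        where
        open ≤-Reasoning
        σ : ℕ → ℕ
        σ T = Σ[ ones ] (events T)
        Σ-* : ∀ Ts → Σ[ σ ] Ts * (2 + n * n) ≡ Σ[ (λ T → σ T * (2 + n * n)) ] Ts
        Σ-* [] = refl
        Σ-* (T ∷ Ts) = trans (*-distribʳ-+ (2 + n * n) (σ T) _) (cong (σ T * (2 + n * n) +_) (Σ-* Ts))
        each : ∀ {T} → T ∈ sizes → σ T * (2 + n * n) ≤ 2 ^ N
        each {T} T∈ with ∈-filter⁻ large? {xs = upTo (suc (n * n))} T∈
        ... | T∈up , big = *-cancelʳ-≤ _ _ (2 ^ (T / 4)) {{m^n≢0 2 (T / 4)}} (begin
          σ T * (2 + n * n) * 2 ^ (T / 4)       ≡⟨ solve 3 (λ a b c → a :* b :* c := b :* (a :* c)) refl (σ T) (2 + n * n) (2 ^ (T / 4)) ⟩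
          (2 + n * n) * (σ T * 2 ^ (T / 4))     ≤⟨ *-monoʳ-≤ (2 + n * n) (Σ-events T) ⟩
          (2 + n * n) * (2 * codes T * 2 ^ N)   ≡⟨ sym (*-assoc (2 + n * n) (2 * codes T) (2 ^ N)) ⟩
          (2 + n * n) * (2 * codes T) * 2 ^ N   ≤⟨ *-monoˡ-≤ (2 ^ N) (few-codes T (≤-pred (∈-upTo⁻ T∈up)) big) ⟩
          2 ^ (T / 4) * 2 ^ N                   ≡⟨ *-comm (2 ^ (T / 4)) (2 ^ N) ⟩
          2 ^ N * 2 ^ (T / 4)                   ∎)

      ramsey : Result
      ramsey = let ω , avoids = avoid N (concatMap events sizes) Σ-all in From.result ω avoids

-- Exponentials, logarithms and integer roots

2^*^≤ : ∀ k j e → 1 ≤ j → j + k ≤ e → 2 ^ k * j ^ e ≤ (j + k) ^ e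
2^*^≤ zero j e 1≤j _ = ≤-reflexive (trans (+-identityʳ (j ^ e)) (cong (_^ e) (sym (+-identityʳ j))))
2^*^≤ (suc k) j e 1≤j j+k≤ = begin
  2 * 2 ^ k * j ^ e     ≡⟨ *-assoc 2 (2 ^ k) (j ^ e) ⟩
  2 * (2 ^ k * j ^ e)   ≤⟨ *-monoʳ-≤ 2 (2^*^≤ k j e 1≤j j+k≤e) ⟩
  2 * (j + k) ^ e       ≤⟨ 2*^≤suc^ j+k≤e (≤-trans 1≤j (m≤m+n j k)) ⟩
  suc (j + k) ^ e       ≡⟨ cong (_^ e) (sym (+-suc j k)) ⟩
  (j + suc k) ^ e       ∎
  where
  open ≤-Reasoning
  j+k≤e : j + k ≤ e
  j+k≤e = ≤-trans (+-monoʳ-≤ j (n≤1+n k)) j+k≤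

-- The bound `e ≥ 2` in the form `(n / (n - k))^n ≥ 2^k`. It holds for every `n > k`, so whichever
-- `n` witnesses `ExpLt` will do.
ExpLt⇒2^< : ∀ {k p q N} → k * q ≤ p → ExpLt p q N → 2 ^ k < N
ExpLt⇒2^< {k} {p} {q} {N} kq≤p (n , p<nq , lt) = *-cancelʳ-< (j ^ n) _ _ (*-cancelʳ-< (q ^ n) _ _ (begin-strict
    2 ^ k * j ^ n * q ^ n      ≤⟨ *-monoˡ-≤ (q ^ n) (2^*^≤ k j n (m<n⇒0<n∸m k<n) (≤-reflexive (m∸n+n≡m (<⇒≤ k<n)))) ⟩
    (j + k) ^ n * q ^ n        ≡⟨ cong (λ z → z ^ n * q ^ n) (m∸n+n≡m (<⇒≤ k<n)) ⟩
    n ^ n * q ^ n              ≡⟨ sym (*-^ n q n) ⟩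
    (n * q) ^ n                <⟨ lt ⟩
    N * (n * q ∸ p) ^ n        ≤⟨ *-monoʳ-≤ N (^-monoˡ-≤ n (∸-monoʳ-≤ (n * q) kq≤p)) ⟩
    N * (n * q ∸ k * q) ^ n    ≡⟨ cong (λ z → N * z ^ n) (sym (*-distribʳ-∸ q n k)) ⟩
    N * (j * q) ^ n            ≡⟨ cong (N *_) (*-^ j q n) ⟩
    N * (j ^ n * q ^ n)        ≡⟨ sym (*-assoc N (j ^ n) (q ^ n)) ⟩
    N * j ^ n * q ^ n          ∎))
  where
  open ≤-Reasoning
  k<n : k < n
  k<n = *-cancelʳ-< q _ _ (≤-<-trans kq≤p p<nq)
  j = n ∸ k

2^≤⇒≤log : ∀ {k N} → 2 ^ k ≤ N → k ≤ ⌊log₂ N ⌋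
2^≤⇒≤log {k} le = subst (_≤ _) (⌊log₂[2^n]⌋≡n k) (⌊log₂⌋-mono-≤ le)

<2^suc-log : ∀ N → N < 2 ^ suc ⌊log₂ N ⌋
<2^suc-log N with N <? 2 ^ suc ⌊log₂ N ⌋
... | yes lt = lt
... | no ¬lt = contradiction (2^≤⇒≤log (≮⇒≥ ¬lt)) (<-irrefl refl)

root : ∀ e .{{_ : NonZero e}} L → ∃ λ p → p ^ e ≤ L × L < suc p ^ e
root e@(suc _) zero = 0 , z≤n , m^n>0 1 e
root e (suc L) with root e L
... | p , lo , hi with suc p ^ e ≤? suc L
... | yes le = suc p , le , <-≤-trans (s≤s hi) (^-monoˡ-< e ≤-refl)
... | no ¬le = p , m≤n⇒m≤1+n lo , ≰⇒> ¬le

n<2^n : ∀ n → n < 2 ^ n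
n<2^n zero    = s≤s z≤n
n<2^n (suc n) = begin-strict
  suc n           ≤⟨ n<2^n n ⟩
  2 ^ n           <⟨ m<m+n (2 ^ n) (m^n>0 2 n) ⟩
  2 ^ n + 2 ^ n   ≡⟨ cong (2 ^ n +_) (sym (+-identityʳ (2 ^ n))) ⟩
  2 ^ suc n       ∎
  where open ≤-Reasoning

-- Numerical estimates for the union bound

x^26 : ∀ x → x ^ 4 * (x * x) ^ 11 ≡ x ^ 26
x^26 x = begin
  x ^ 4 * (x * x) ^ 11        ≡⟨ cong (x ^ 4 *_) (*-^ x x 11) ⟩
  x ^ 4 * (x ^ 11 * x ^ 11)   ≡⟨ cong (x ^ 4 *_) (sym (^-distribˡ-+-* x 11 11)) ⟩
  x ^ 4 * x ^ 22              ≡⟨ sym (^-distribˡ-+-* x 4 22) ⟩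
  x ^ 26                      ∎
  where open ≡-Reasoning

x^25 : ∀ a x → (a * (x * x)) ^ 11 * x ^ 3 ≡ a ^ 11 * x ^ 25
x^25 a x = begin
  (a * (x * x)) ^ 11 * x ^ 3           ≡⟨ cong (_* x ^ 3) (*-^ a (x * x) 11) ⟩
  a ^ 11 * (x * x) ^ 11 * x ^ 3        ≡⟨ *-assoc (a ^ 11) ((x * x) ^ 11) (x ^ 3) ⟩
  a ^ 11 * ((x * x) ^ 11 * x ^ 3)      ≡⟨ cong (λ z → a ^ 11 * (z * x ^ 3)) (trans (*-^ x x 11) (sym (^-distribˡ-+-* x 11 11))) ⟩
  a ^ 11 * (x ^ 22 * x ^ 3)            ≡⟨ cong (a ^ 11 *_) (sym (^-distribˡ-+-* x 22 3)) ⟩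
  a ^ 11 * x ^ 25                      ∎
  where open ≡-Reasoning

threshold : ℕ → ℕ → ℕ
threshold a b = a ^ 11 * b ^ 25

-- Inserting `T ≤ n b p^3` leaves `n ≤ a^11 b^25 p^(26 + 75)`, against `n ≥ p^102`; the one
-- remaining factor `p` is bounded by a constant. Hence the exponent 102 = 26 + 3 · 25 + 1.
few-quotients⇒≤threshold : ∀ a b {p n m T z} → 1 ≤ p → m ≤ p → p ^ 102 ≤ n → z ≡ b * p ^ 3 → T ≤ n * z →
  n ^ 4 * (n * n) ^ 11 ≤ m ^ 4 * (m * m) ^ 11 * ((a * (T * T)) ^ 11 * T ^ 3) → p ≤ threshold a b
few-quotients⇒≤threshold a b {p} {n} {m} {T} {z} 1≤p m≤p p^102≤n z≡ T≤nz large =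
  *-cancelʳ-≤ p (threshold a b) (p ^ 101) {{m^n≢0 p 101 {{>-nonZero 1≤p}}}} (begin
    p ^ 102                                      ≤⟨ p^102≤n ⟩
    n                                            ≤⟨ n≤ ⟩
    p ^ 26 * (a ^ 11 * z ^ 25)                   ≡⟨ cong (λ y → p ^ 26 * (a ^ 11 * y)) z^25 ⟩
    p ^ 26 * (a ^ 11 * (b ^ 25 * p ^ 75))        ≡⟨ solve 4 (λ a b c d → a :* (b :* (c :* d)) := b :* c :* (a :* d)) refl (p ^ 26) (a ^ 11) (b ^ 25) (p ^ 75) ⟩
    a ^ 11 * b ^ 25 * (p ^ 26 * p ^ 75)          ≡⟨ cong (a ^ 11 * b ^ 25 *_) (sym (^-distribˡ-+-* p 26 75)) ⟩
    threshold a b * p ^ 101                      ∎)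
  where
  open ≤-Reasoning
  1≤n : 1 ≤ n
  1≤n = ≤-trans (m^n>0 p {{>-nonZero 1≤p}} 102) p^102≤n
  n≤ : n ≤ p ^ 26 * (a ^ 11 * z ^ 25)
  n≤ = *-cancelʳ-≤ n _ (n ^ 25) {{m^n≢0 n 25 {{>-nonZero 1≤n}}}} (begin
    n ^ 26                                       ≡⟨ sym (x^26 n) ⟩
    n ^ 4 * (n * n) ^ 11                         ≤⟨ large ⟩
    m ^ 4 * (m * m) ^ 11 * ((a * (T * T)) ^ 11 * T ^ 3) ≡⟨ cong₂ _*_ (x^26 m) (x^25 a T) ⟩
    m ^ 26 * (a ^ 11 * T ^ 25)                   ≤⟨ *-mono-≤ (^-monoˡ-≤ 26 m≤p) (*-monoʳ-≤ (a ^ 11) (^-monoˡ-≤ 25 T≤nz)) ⟩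
    p ^ 26 * (a ^ 11 * (n * z) ^ 25)             ≡⟨ cong (λ y → p ^ 26 * (a ^ 11 * y)) (*-^ n z 25) ⟩
    p ^ 26 * (a ^ 11 * (n ^ 25 * z ^ 25))        ≡⟨ solve 4 (λ a b c d → a :* (b :* (c :* d)) := a :* (b :* d) :* c) refl (p ^ 26) (a ^ 11) (n ^ 25) (z ^ 25) ⟩
    p ^ 26 * (a ^ 11 * z ^ 25) * n ^ 25          ∎)
  z^25 : z ^ 25 ≡ b ^ 25 * p ^ 75
  z^25 = trans (cong (_^ 25) z≡) (trans (*-^ b (p ^ 3) 25) (cong (b ^ 25 *_) (^-*-assoc p 3 25)))

module Estimates (e : ℕ) (102≤e : 102 ≤ e) where

  -- `σ` bounds `s / p`; the summands of `κ` are the coefficients of `p^3 n` in the three parts of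
  -- `rest`; beyond `c₀` the parameter `p` contradicts `few-quotients⇒≤threshold`.
  σ κ c₀ : ℕ
  σ  = e + 8
  κ  = (2 * σ + 1) + (2 + 2 * σ) + (6 + σ) * (1 + 16 * σ)
  c₀ = threshold 4 (16 * κ)

  module _ {L p m N T : ℕ} (p^e≤L : p ^ e ≤ L) (L<p⁺ : L < suc p ^ e) (c₀<p : c₀ < p) (m≤p : m ≤ p)
           (N<2^ : N < 2 ^ suc L) where

    q n s k ℓ : ℕ
    q = 64 * L
    n = 4 * q
    -- Since `n = 256 L` and `L < (p + 1)^e ≤ 2^(p e)`, this gives `n < 2^s`.
    s = e * p + 8
    k = 2 * m * s
    ℓ = 1 + 8 * k

    private
      open ≤-Reasoning

      1≤p : 1 ≤ p
      1≤p = ≤-trans (s≤s z≤n) c₀<p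

      1≤L : 1 ≤ L
      1≤L = ≤-trans (m^n>0 p {{>-nonZero 1≤p}} e) p^e≤L

      L≤n : L ≤ n
      L≤n = ≤-trans (m≤n*m L 64) (m≤n*m q 4)

      L+1≤n : suc L ≤ n
      L+1≤n = begin
        1 + L         ≤⟨ +-monoˡ-≤ L 1≤L ⟩
        L + L         ≤⟨ m≤m+n (L + L) (254 * L) ⟩
        L + L + 254 * L ≡⟨ solve 1 (λ L → L :+ L :+ con 254 :* L := con 4 :* (con 64 :* L)) refl L ⟩
        n             ∎

      s≤σp : s ≤ σ * p
      s≤σp = begin
        e * p + 8       ≤⟨ +-monoʳ-≤ (e * p) (*-monoʳ-≤ 8 1≤p) ⟩
        e * p + 8 * p   ≡⟨ sym (*-distribʳ-+ p e 8) ⟩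
        σ * p           ∎

      p²≤p³ : p * p ≤ p * p * p
      p²≤p³ = ≤-trans (≤-reflexive (sym (*-identityʳ (p * p)))) (*-monoʳ-≤ (p * p) 1≤p)

      p≤p² : p ≤ p * p
      p≤p² = ≤-trans (≤-reflexive (sym (*-identityʳ p))) (*-monoʳ-≤ p 1≤p)

      1≤p² : 1 ≤ p * p
      1≤p² = *-mono-≤ 1≤p 1≤p

      k≤ : k ≤ 2 * σ * (p * p)
      k≤ = begin
        2 * m * s             ≤⟨ *-mono-≤ (*-monoʳ-≤ 2 m≤p) s≤σp ⟩
        2 * p * (σ * p)       ≡⟨ solve 2 (λ p σ → con 2 :* p :* (σ :* p) := con 2 :* σ :* (p :* p)) refl p σ ⟩
        2 * σ * (p * p)       ∎

    4q<2^s : 4 * q < 2 ^ s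
    4q<2^s = begin-strict
      4 * (64 * L)            ≡⟨ solve 1 (λ L → con 4 :* (con 64 :* L) := con 256 :* L) refl L ⟩
      256 * L                 <⟨ *-monoʳ-< 256 L<p⁺ ⟩
      256 * suc p ^ e         ≤⟨ *-monoʳ-≤ 256 (^-monoˡ-≤ e (n<2^n p)) ⟩
      2 ^ 8 * (2 ^ p) ^ e     ≡⟨ cong (2 ^ 8 *_) (^-*-assoc 2 p e) ⟩
      2 ^ 8 * 2 ^ (p * e)     ≡⟨ *-comm (2 ^ 8) (2 ^ (p * e)) ⟩
      2 ^ (p * e) * 2 ^ 8     ≡⟨ sym (^-distribˡ-+-* 2 (p * e) 8) ⟩
      2 ^ (p * e + 8)         ≡⟨ cong (λ z → 2 ^ (z + 8)) (*-comm p e) ⟩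
      2 ^ s                   ∎

    private
      Z : ℕ
      Z = 16 * (κ * (p * p * p))

    -- A family with few quotients would force p ≤ c₀, because p^102 ≤ p^e ≤ n.
    T-large : n ^ 4 * (n * n) ^ 11 ≤ m ^ 4 * (m * m) ^ 11 * ((4 * (T * T)) ^ 11 * T ^ 3) → n * Z ≤ T
    T-large large = ≮⇒≥ λ T<nZ → <⇒≱ c₀<p (few-quotients⇒≤threshold 4 (16 * κ) {p} {n} {m} {T} {Z} 1≤p m≤p
      (≤-trans (^-monoʳ-≤ p {{>-nonZero 1≤p}} 102≤e) (≤-trans p^e≤L L≤n))
      (trans (sym (*-assoc 16 κ (p * p * p)))
             (cong (16 * κ *_) (solve 1 (λ p → p :* p :* p := p :* (p :* (p :* con 1))) refl p)))
      (<⇒≤ T<nZ) large)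

    module _ {τ : ℕ} (τq≤T : τ * q ≤ T) (T≤n² : T ≤ n * n) (nZ≤T : n * Z ≤ T) where

      g u rest : ℕ
      g = τ + m + k + 1 + τ
      -- Bits per letter: `T ≤ n²` gives `τ ≤ 4 n`, so the alphabet has at most `32 · 2^s · 2^p`
      -- letters.
      u = 5 + s + p
      -- All bits except those for the `2 τ` covering generators: `2 s + 1` for the sizes and the
      -- two colours, `L + 1` for each other generator, `u` for each letter of the `n` words.
      rest = s + s + 1 + suc L * (m + k + 1) + u * (ℓ * n)

      private
        τ≤4n : τ ≤ 4 * n
        τ≤4n = *-cancelʳ-≤ τ (4 * n) q {{>-nonZero (≤-trans 1≤L (m≤n*m L 64))}} (begin
          τ * q         ≤⟨ τq≤T ⟩
          T             ≤⟨ T≤n² ⟩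
          n * (4 * q)   ≡⟨ solve 2 (λ n q → n :* (con 4 :* q) := con 4 :* n :* q) refl n q ⟩
          4 * n * q     ∎)

        X : ℕ
        X = 2 ^ s * 2 ^ p

        1≤X : 1 ≤ X
        1≤X = *-mono-≤ (m^n>0 2 s) (m^n>0 2 p)

        m≤X : m ≤ X
        m≤X = ≤-trans m≤p (≤-trans (<⇒≤ (n<2^n p)) (m≤n*m (2 ^ p) (2 ^ s) {{m^n≢0 2 s}}))

        ms≤X : m * s ≤ X
        ms≤X = begin
          m * s           ≤⟨ *-mono-≤ (≤-trans m≤p (<⇒≤ (n<2^n p))) (<⇒≤ (n<2^n s)) ⟩
          2 ^ p * 2 ^ s   ≡⟨ *-comm (2 ^ p) (2 ^ s) ⟩
          X               ∎

        n≤X : n ≤ X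
        n≤X = ≤-trans (<⇒≤ 4q<2^s) (m≤m*n (2 ^ s) (2 ^ p) {{m^n≢0 2 p}})

        alphabet≤ : 1 + (g + g) ≤ 2 ^ u
        alphabet≤ = begin
          1 + (g + g)
            ≤⟨ +-monoʳ-≤ 1 (+-mono-≤ g≤ g≤) ⟩
          1 + ((4 * n + m + k + 1 + 4 * n) + (4 * n + m + k + 1 + 4 * n))
            ≡⟨ solve 3 (λ n m s → con 1 :+ ((con 4 :* n :+ m :+ con 2 :* m :* s :+ con 1 :+ con 4 :* n) :+ (con 4 :* n :+ m :+ con 2 :* m :* s :+ con 1 :+ con 4 :* n))
                          := con 3 :* con 1 :+ con 2 :* m :+ con 4 :* (m :* s) :+ con 16 :* n) refl n m s ⟩
          3 * 1 + 2 * m + 4 * (m * s) + 16 * n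
            ≤⟨ +-mono-≤ (+-mono-≤ (+-mono-≤ (*-monoʳ-≤ 3 1≤X) (*-monoʳ-≤ 2 m≤X)) (*-monoʳ-≤ 4 ms≤X)) (*-monoʳ-≤ 16 n≤X) ⟩
          3 * X + 2 * X + 4 * X + 16 * X
            ≤⟨ m≤m+n _ (7 * X) ⟩
          3 * X + 2 * X + 4 * X + 16 * X + 7 * X
            ≡⟨ solve 1 (λ X → con 3 :* X :+ con 2 :* X :+ con 4 :* X :+ con 16 :* X :+ con 7 :* X := con 32 :* X) refl X ⟩
          2 ^ 5 * (2 ^ s * 2 ^ p)
            ≡⟨ sym (*-assoc (2 ^ 5) (2 ^ s) (2 ^ p)) ⟩
          2 ^ 5 * 2 ^ s * 2 ^ p
            ≡⟨ cong (_* 2 ^ p) (sym (^-distribˡ-+-* 2 5 s)) ⟩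
          2 ^ (5 + s) * 2 ^ p
            ≡⟨ sym (^-distribˡ-+-* 2 (5 + s) p) ⟩
          2 ^ u ∎
          where
          g≤ : g ≤ 4 * n + m + k + 1 + 4 * n
          g≤ = +-mono-≤ (+-monoˡ-≤ 1 (+-monoˡ-≤ k (+-monoˡ-≤ m τ≤4n))) τ≤4n

        2+n²≤ : 2 + n * n ≤ 2 ^ (s + s)
        2+n²≤ = begin
          2 + n * n                ≤⟨ +-monoˡ-≤ (n * n) (+-monoʳ-≤ 1 (≤-trans 1≤L L≤n)) ⟩
          1 + n + n * n            ≤⟨ m≤m+n _ n ⟩
          1 + n + n * n + n        ≡⟨ solve 1 (λ n → con 1 :+ n :+ n :* n :+ n := (con 1 :+ n) :* (con 1 :+ n)) refl n ⟩
          suc n * suc n            ≤⟨ *-mono-≤ 4q<2^s 4q<2^s ⟩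
          2 ^ s * 2 ^ s            ≡⟨ sym (^-distribˡ-+-* 2 s s) ⟩
          2 ^ (s + s)              ∎

        rest≤ : rest ≤ κ * (p * p * p) * n
        rest≤ = begin
          s + s + 1 + suc L * (m + k + 1) + u * (ℓ * n)
            ≤⟨ +-mono-≤ (+-mono-≤ a≤ b≤) c≤ ⟩
          (2 * σ + 1) * P * n + (2 + 2 * σ) * P * n + (6 + σ) * (1 + 16 * σ) * P * n
            ≡⟨ solve 5 (λ a b c P n → a :* P :* n :+ b :* P :* n :+ c :* P :* n := (a :+ b :+ c) :* P :* n) refl
                 (2 * σ + 1) (2 + 2 * σ) ((6 + σ) * (1 + 16 * σ)) P n ⟩
          κ * P * n ∎
          where
          P = p * p * p
          1≤n : 1 ≤ n
          1≤n = ≤-trans 1≤L L≤n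
          p≤P : p ≤ P
          p≤P = ≤-trans p≤p² p²≤p³
          a≤ : s + s + 1 ≤ (2 * σ + 1) * P * n
          a≤ = begin
            s + s + 1                ≤⟨ +-mono-≤ (+-mono-≤ s≤σp s≤σp) 1≤p ⟩
            σ * p + σ * p + p        ≡⟨ solve 2 (λ σ p → σ :* p :+ σ :* p :+ p := (con 2 :* σ :+ con 1) :* p :* con 1) refl σ p ⟩
            (2 * σ + 1) * p * 1      ≤⟨ *-mono-≤ (*-monoʳ-≤ (2 * σ + 1) p≤P) 1≤n ⟩
            (2 * σ + 1) * P * n      ∎
          mk1 : m + k + 1 ≤ (2 + 2 * σ) * (p * p)
          mk1 = begin
            m + k + 1                              ≤⟨ +-mono-≤ (+-mono-≤ (≤-trans m≤p p≤p²) k≤) 1≤p² ⟩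
            p * p + 2 * σ * (p * p) + p * p        ≡⟨ solve 2 (λ σ x → x :+ con 2 :* σ :* x :+ x := (con 2 :+ con 2 :* σ) :* x) refl σ (p * p) ⟩
            (2 + 2 * σ) * (p * p)                  ∎
          b≤ : suc L * (m + k + 1) ≤ (2 + 2 * σ) * P * n
          b≤ = begin
            suc L * (m + k + 1)            ≤⟨ *-mono-≤ L+1≤n (≤-trans mk1 (*-monoʳ-≤ (2 + 2 * σ) p²≤p³)) ⟩
            n * ((2 + 2 * σ) * P)          ≡⟨ *-comm n _ ⟩
            (2 + 2 * σ) * P * n            ∎
          u≤ : u ≤ (6 + σ) * p
          u≤ = begin
            5 + s + p              ≤⟨ +-monoˡ-≤ p (+-mono-≤ (*-monoʳ-≤ 5 1≤p) s≤σp) ⟩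
            5 * p + σ * p + p      ≡⟨ solve 2 (λ σ p → con 5 :* p :+ σ :* p :+ p := (con 6 :+ σ) :* p) refl σ p ⟩
            (6 + σ) * p            ∎
          ℓ≤ : ℓ ≤ (1 + 16 * σ) * (p * p)
          ℓ≤ = begin
            1 + 8 * k                              ≤⟨ +-mono-≤ 1≤p² (*-monoʳ-≤ 8 k≤) ⟩
            p * p + 8 * (2 * σ * (p * p))          ≡⟨ solve 2 (λ σ x → x :+ con 8 :* (con 2 :* σ :* x) := (con 1 :+ con 16 :* σ) :* x) refl σ (p * p) ⟩
            (1 + 16 * σ) * (p * p)                 ∎
          c≤ : u * (ℓ * n) ≤ (6 + σ) * (1 + 16 * σ) * P * n
          c≤ = begin
            u * (ℓ * n)                                          ≤⟨ *-mono-≤ u≤ (*-monoˡ-≤ n ℓ≤) ⟩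
            (6 + σ) * p * ((1 + 16 * σ) * (p * p) * n)           ≡⟨ solve 4 (λ a b p n → a :* p :* (b :* (p :* p) :* n) := a :* b :* (p :* p :* p) :* n) refl (6 + σ) (1 + 16 * σ) p n ⟩
            (6 + σ) * (1 + 16 * σ) * P * n                       ∎

        exponent : ℕ
        exponent = s + s + (1 + (suc L * g + u * (ℓ * n)))

        -- The covering generators cost `2 τ (L + 1) ≤ 4 L τ ≤ T / 16` bits, because `q = 64 L` and
        -- `τ q ≤ T`; the others cost at most `n Z / 16 ≤ T / 16`. Together this is half of the
        -- available `T / 4`.
        exponent≤ : exponent ≤ T / 4
        exponent≤ = subst (_≤ T / 4) (m*n/n≡m exponent 4) (/-monoˡ-≤ {exponent * 4} {T} 4 (*-cancelˡ-≤ {exponent * 4} {T} 4 (begin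
            4 * (exponent * 4)
              ≡⟨ solve 7 (λ s L τ m k u x → con 4 :* ((s :+ s :+ (con 1 :+ ((con 1 :+ L) :* (τ :+ m :+ k :+ con 1 :+ τ) :+ u :* x))) :* con 4)
                    := con 16 :* (s :+ s :+ con 1 :+ (con 1 :+ L) :* (m :+ k :+ con 1) :+ u :* x) :+ (con 1 :+ L) :* (con 32 :* τ)) refl s L τ m k u (ℓ * n) ⟩
            16 * rest + suc L * (32 * τ)
              ≤⟨ +-mono-≤ (*-monoʳ-≤ 16 rest≤) (*-monoˡ-≤ (32 * τ) (+-monoˡ-≤ L 1≤L)) ⟩
            16 * (κ * (p * p * p) * n) + (L + L) * (32 * τ)
              ≡⟨ cong₂ _+_ (solve 2 (λ a n → con 16 :* (a :* n) := n :* (con 16 :* a)) refl (κ * (p * p * p)) n)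
                           (solve 2 (λ L τ → (L :+ L) :* (con 32 :* τ) := τ :* (con 64 :* L)) refl L τ) ⟩
            n * Z + τ * q
              ≤⟨ +-mono-≤ nZ≤T τq≤T ⟩
            T + T
              ≤⟨ m≤m+n (T + T) (T + T) ⟩
            T + T + (T + T)
              ≡⟨ solve 1 (λ T → T :+ T :+ (T :+ T) := con 4 :* T) refl T ⟩
            4 * T ∎)))

      few : (2 + n * n) * (2 * (N ^ g * ((1 + (g + g)) ^ ℓ) ^ n)) ≤ 2 ^ (T / 4)
      few = begin
        (2 + n * n) * (2 * (N ^ g * ((1 + (g + g)) ^ ℓ) ^ n))
          ≤⟨ *-mono-≤ 2+n²≤ (*-monoʳ-≤ 2 (*-mono-≤ (^-monoˡ-≤ g (<⇒≤ N<2^)) (^-monoˡ-≤ n (^-monoˡ-≤ ℓ alphabet≤)))) ⟩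
        2 ^ (s + s) * (2 * ((2 ^ suc L) ^ g * ((2 ^ u) ^ ℓ) ^ n))
          ≡⟨ cong (λ z → 2 ^ (s + s) * (2 * z)) (cong₂ _*_ (^-*-assoc 2 (suc L) g)
               (trans (^-*-assoc (2 ^ u) ℓ n) (^-*-assoc 2 u (ℓ * n)))) ⟩
        2 ^ (s + s) * (2 * (2 ^ (suc L * g) * 2 ^ (u * (ℓ * n))))
          ≡⟨ cong (λ z → 2 ^ (s + s) * (2 * z)) (sym (^-distribˡ-+-* 2 (suc L * g) (u * (ℓ * n)))) ⟩
        2 ^ (s + s) * 2 ^ (1 + (suc L * g + u * (ℓ * n)))
          ≡⟨ sym (^-distribˡ-+-* 2 (s + s) (1 + (suc L * g + u * (ℓ * n)))) ⟩
        2 ^ exponent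
          ≤⟨ ^-monoʳ-≤ 2 exponent≤ ⟩
        2 ^ (T / 4) ∎

-- The hypothesis yields `m^e ≤ log N` for the number `m` of cosets, hence `m ≤ p` for the integer
-- `e`-th root `p`. For `p > c₀` the union bound applies; a smaller `p` bounds `N`, and the constant
-- `C` absorbs these groups.
ramsey-cayley : ∀ e → 102 ≤ e → ∃[ C ] ((N : ℕ) (G : FiniteGroup N) (H : Subset N) →
    IsAbelianSubgroup G H →
    Coprime ∣ H ∣ 6 →
    ExpLt (N ^ e) (∣ H ∣ ^ e) N →
    ∃[ S ] (IsConnectionSet G S × IsRamsey G C S))
ramsey-cayley e 102≤e = C , construct
  where
  open Estimates e 102≤e using (c₀; 4q<2^s; T-large; few)
  instance
    e≢0 : NonZero e
    e≢0 = >-nonZero (≤-trans (s≤s z≤n) 102≤e)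
  C : ℕ
  C = 256 + 2 ^ suc (suc c₀ ^ e)
  construct : (N : ℕ) (G : FiniteGroup N) (H : Subset N) → IsAbelianSubgroup G H → Coprime ∣ H ∣ 6 →
              ExpLt (N ^ e) (∣ H ∣ ^ e) N → ∃[ S ] (IsConnectionSet G S × IsRamsey G C S)
  construct N G H isAbelian coprime expLt = with-transversal (Existence.transversal G H isAbelian coprime)
    where
    open FiniteGroup G
    open ≤-Reasoning
    L = ⌊log₂ N ⌋
    with-transversal : (∃ λ Tr → length Tr * ∣ H ∣ ≤ N × (∀ v → ∃ λ x → x ∈ Tr × (v ∙ (x ⁻¹)) ∈ₛ H)) →
                       ∃[ S ] (IsConnectionSet G S × IsRamsey G C S)
    with-transversal (Tr , mh≤N , transv) = cases (root e L)
      where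
      m^e≤L : length Tr ^ e ≤ L
      m^e≤L = 2^≤⇒≤log {length Tr ^ e} {N} (<⇒≤ (ExpLt⇒2^< {length Tr ^ e} {N ^ e} {∣ H ∣ ^ e} {N}
        (≤-trans (≤-reflexive (sym (*-^ (length Tr) ∣ H ∣ e))) (^-monoˡ-≤ e mh≤N)) expLt))
      1≤L : 1 ≤ L
      1≤L = ≤-trans (m^n>0 (length Tr) {{>-nonZero (∈-length (proj₁ (proj₂ (transv ε))))}} e) m^e≤L
      cases : (∃ λ p → p ^ e ≤ L × L < suc p ^ e) → ∃[ S ] (IsConnectionSet G S × IsRamsey G C S)
      cases (p , p^e≤L , L<p⁺) = decide (c₀ <? p)
        where
        decide : Dec (c₀ < p) → ∃[ S ] (IsConnectionSet G S × IsRamsey G C S)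
        -- Here `N` is at most the second summand of `C`, so even the empty connection set will do;
        -- `1 ≤ L` turns the constant into a multiple of `L`.
        decide (no c₀≮p) = Subset.⊥ , (∉⊥ , λ x x∈ → contradiction x∈ ∉⊥) , (λ K _ → trivial K) , (λ K _ → trivial K)
          where
          trivial : ∀ K → ∣ K ∣ ≤ C * L
          trivial K = begin
            ∣ K ∣                         ≤⟨ ∣p∣≤n K ⟩
            N                             ≤⟨ <⇒≤ (<2^suc-log N) ⟩
            2 ^ suc L                     ≤⟨ ^-monoʳ-≤ 2 (s≤s (<⇒≤ (<-≤-trans L<p⁺ (^-monoˡ-≤ e (s≤s (≮⇒≥ c₀≮p)))))) ⟩
            2 ^ suc (suc c₀ ^ e)          ≤⟨ m≤n+m _ 256 ⟩
            C                             ≡⟨ sym (*-identityʳ C) ⟩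
            C * 1                         ≤⟨ *-monoʳ-≤ C 1≤L ⟩
            C * L                         ∎
        decide (yes c₀<p) = result (ramsey (64 * L) {{q≢0}} (e * p + 8) (4q<2^s {T = 0} p^e≤L L<p⁺ c₀<p m≤p (<2^suc-log N)) fewCodes)
          where
          open Union G H isAbelian coprime Tr transv using (ramsey)
          q≢0 : NonZero (64 * L)
          q≢0 = >-nonZero (≤-trans 1≤L (m≤n*m L 64))
          m≤p : length Tr ≤ p
          m≤p = ≮⇒≥ (λ p<m → <-irrefl refl (<-≤-trans L<p⁺ (≤-trans (^-monoˡ-≤ e p<m) m^e≤L)))
          fewCodes = λ T T≤n² large → few p^e≤L L<p⁺ c₀<p m≤p (<2^suc-log N) {τ = _/_ T (64 * L) {{q≢0}}} (m/n*n≤m T (64 * L) {{q≢0}}) T≤n²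
                       (T-large p^e≤L L<p⁺ c₀<p m≤p (<2^suc-log N) large)
          result : (∃ λ S → IsConnectionSet G S × (∀ K → IsClique G S K → ∣ K ∣ ≤ 4 * (64 * L)) × (∀ K → IsIndependent G S K → ∣ K ∣ ≤ 4 * (64 * L))) →
                   ∃[ S ] (IsConnectionSet G S × IsRamsey G C S)
          result (S , conn , cl , ind) = S , conn , (λ K h → ≤-trans (cl K h) bound) , (λ K h → ≤-trans (ind K h) bound)
            where
            bound : 4 * (64 * L) ≤ C * L
            bound = ≤-trans (≤-reflexive (sym (*-assoc 4 64 L))) (*-mono-≤ {256} {C} {L} {L} (m≤m+n 256 (2 ^ suc (suc c₀ ^ e))) ≤-refl)

theorem4p3 : ∃[ C ] ((N : ℕ) (G : FiniteGroup N) (H : Subset N) →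
    IsAbelianSubgroup G H →
    Coprime ∣ H ∣ 6 →
    ExpLt (N ^ 1000) (∣ H ∣ ^ 1000) N →
    ∃[ S ] (IsConnectionSet G S × IsRamsey G C S))
theorem4p3 = ramsey-cayley 1000 (≤ᵇ⇒≤ 102 1000 _)
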